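{- Let $T$ be a regular tournament on $n\geq 9$ vertices. If $\pi_2(T)> (n-9)/12$, then $T$ is path extendable.
   Context: A tournament is regular if every vertex has out-degree equal to its in-degree. For distinct vertices $u,v$ of a tournament $T$, $p_2(u,v)$ denotes the number of directed paths of length $2$ (with $2$ arcs) from $u$ to $v$ in $T$, and $\pi_2(T)=\min\{p_2(u,v) : u,v\in V(T),\ u\neq v\}$. All paths are directed paths. A path $P$ that is not hamiltonian is called extendable if there is a path $P'$ with the same initial and the same terminal vertex as $P$ and $V(P')=V(P)\cup\{w\}$ for some vertex $w\in V(T)\setminus V(P)$. A digraph is path extendable if every nonhamiltonian path of length at least $1$ in it is extendable. -}

module Defs where

open import Data.Nat using (ℕ; zero; suc; _+_)
open import Data.Fin using (Fin)
open import Data.Bool using (Bool; true; false)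
open import Data.List using (List; []; _∷_; length; allFin; filter; head; last)
open import Data.List.Relation.Unary.Unique.Propositional using (Unique)
open import Data.List.Membership.Propositional using (_∈_)
open import Data.Product using (Σ; _×_; _,_)
open import Data.Sum using (_⊎_)
open import Relation.Nullary using (¬_)
open import Relation.Binary.PropositionalEquality using (_≡_; _≢_)
open import Data.Bool.Properties using (T?)
open import Data.Bool using (T; _∧_)
open import Function.Bundles using (_⇔_)

Digraph : ℕ → Set
Digraph n = Fin n → Fin n → Bool

_⟶[_]_ : ∀ {n} → Fin n → Digraph n → Fin n → Set
u ⟶[ D ] v = T (D u v)

record IsTournament {n : ℕ} (D : Digraph n) : Set where
  field
    irrefl : ∀ u → ¬ (u ⟶[ D ] u)
    total  : ∀ u v → u ≢ v → (u ⟶[ D ] v) ⊎ (v ⟶[ D ] u)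
    asym   : ∀ u v → u ⟶[ D ] v → ¬ (v ⟶[ D ] u)

countV : ∀ {n} → (Fin n → Bool) → ℕ
countV {n} p = length (filter (λ x → T? (p x)) (allFin n))

outdeg indeg : ∀ {n} → Digraph n → Fin n → ℕ
outdeg D u = countV (λ v → D u v)
indeg  D u = countV (λ v → D v u)

IsRegular : ∀ {n} → Digraph n → Set
IsRegular D = ∀ u → outdeg D u ≡ indeg D u

p₂ : ∀ {n} → Digraph n → Fin n → Fin n → ℕ
p₂ D u v = countV (λ w → D u w ∧ D w v)

data Walk {n : ℕ} (D : Digraph n) : List (Fin n) → Set where
  single : ∀ x → Walk D (x ∷ [])
  step   : ∀ x y xs → x ⟶[ D ] y → Walk D (y ∷ xs) → Walk D (x ∷ y ∷ xs)

-- a (directed) path: a nonempty vertex sequence, pairwise distinct, consecutive arcs.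
-- Its length (number of arcs) is length P ∸ 1.
IsPath : ∀ {n} → Digraph n → List (Fin n) → Set
IsPath D P = Walk D P × Unique P

IsHamiltonian : ∀ {n} → List (Fin n) → Set
IsHamiltonian {n} P = length P ≡ n

Extendable : ∀ {n} → Digraph n → List (Fin n) → Set
Extendable {n} D P =
  Σ (List (Fin n)) λ P' → Σ (Fin n) λ w →
    IsPath D P' × head P' ≡ head P × last P' ≡ last P ×
    ¬ (w ∈ P) × (∀ x → (x ∈ P') ⇔ (x ∈ P ⊎ x ≡ w))

-- every nonhamiltonian path of length ≥ 1 (i.e. ≥ 2 vertices) is extendable
PathExtendable : ∀ {n} → Digraph n → Set
PathExtendable D = ∀ P → IsPath D P → 2 Data.Nat.≤ length P → ¬ IsHamiltonian P → Extendable D P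

{-# OPTIONS --safe #-}

-- Let v 0, …, v r be a path that cannot be extended. A vertex w off the path cannot be inserted between
-- consecutive vertices, so it has a threshold t: it dominates v i for i < t and is dominated by the others.
--
-- If some threshold lies between 2 and r - 1, swapping two segments of the path shows that v 0 → v (b + 1)
-- and v b → v r exclude each other for 0 < b < r - 1. As the out-degree of v 0 and the in-degree of v r in
-- the path add up to r plus the number of thresholds other than 0 and r + 1, there are at most two of these.
-- If there are two, no two-path joins v (r - 1) to v r or none joins v 0 to v 1. If there is one, it is
-- (r + 1) / 2, the arcs at both ends are determined, and reversing four segments gives an extension.
--
-- Otherwise all thresholds are at most 1 (l of them) or at least r (u of them). Let x be the out-degree of
-- v 1 and y the in-degree of v (r - 1) in the path, so that x + l = y + u = (n - 1) / 2. Two-paths from v 1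
-- stay in the path, so averaging in-degrees inside the out-neighbourhood of v 1 gives x ≥ 2 π₂ + 1, and
-- likewise y ≥ 2 π₂ + 1. Counting the arcs that leave the l vertices gives l ≥ 2 y, and likewise u ≥ 2 x,
-- with enough slack for n ≥ 12 π₂ + 9.
module Submission where

open import Defs
open import Data.Bool using (Bool; true; false; T; _∧_; not)
open import Data.Bool.Properties using (T?)
open import Data.Empty using (⊥; ⊥-elim)
open import Data.Fin using (Fin; zero; suc; toℕ; fromℕ<)
import Data.Fin.Properties as Fin
open import Data.List using (List; []; _∷_; _++_; length; head; last; filter; tabulate)
open import Data.List.Membership.DecPropositional using (_∈?_)
open import Data.List.Membership.Propositional using (_∈_; _∉_)
open import Data.List.Relation.Binary.Permutation.Propositional using (_↭_; ↭-sym; ↭-trans; ↭-reflexive; ↭⇒↭ₛ)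
open import Data.List.Relation.Binary.Permutation.Propositional.Properties
  using (∈-resp-↭; ↭-length; ++-commutativeMonoid)
import Data.List.Relation.Binary.Permutation.Setoid.Properties as Permutationₛ
open import Data.List.Relation.Unary.All as All using (_∷_)
open import Data.List.Relation.Unary.All.Properties using (¬Any⇒All¬)
open import Data.List.Relation.Unary.AllPairs using (_∷_)
open import Data.List.Relation.Unary.Any using (here; there)
open import Data.List.Relation.Unary.Unique.DecPropositional using (unique?)
open import Data.List.Relation.Unary.Unique.Propositional using (Unique)
open import Data.Maybe.Properties using (≡-dec)
open import Data.Nat
open import Data.Nat.DivMod using (m≡m%n+[m/n]*n; m%n<n; m<n*o⇒m/o<n)
open import Data.Nat.Divisibility using (_∣_; divides; ∣m+n∣m⇒∣n; m∣m*n; ∣⇒≤; ∣m∣n⇒∣m+n; ∣-refl)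
open import Data.Nat.Properties
open import Data.Nat.Tactic.RingSolver using (solve-∀)
open import Data.Product using (∃; _×_; _,_)
open import Data.Sum using (_⊎_; inj₁; inj₂)
open import Data.Unit using (tt)
open import Function using (_∘_; flip)
open import Function.Bundles using (_⇔_; mk⇔; Equivalence)
open import Relation.Binary.Definitions using (tri<; tri≈; tri>)
open import Relation.Binary.PropositionalEquality
open import Relation.Nullary using (¬_; Dec; yes; no; does; contradiction)
open import Relation.Nullary.Decidable using (map′; _×-dec_; _⊎-dec_; _→-dec_; ¬?; dec-true; dec-false)
import Algebra.Solver.CommutativeMonoid as CommutativeMonoidSolver
open import Algebra.Properties.CommutativeMonoid.Sum +-0-commutativeMonoid
  using (sum; sum-cong-≗; ∑-distrib-+; ∑-comm)
open import Algebra.Properties.Semiring.Sum +-*-semiring using (*-distribˡ-sum; *-distribʳ-sum)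

private variable
  A : Set
  k n : ℕ

-- Exchanges along a path

segment : (ℕ → A) → ℕ → ℕ → List A
segment v i zero    = []
segment v i (suc k) = v i ∷ segment v (suc i) k

-- The first block is nonempty, so its last index is `i + k` and the second block starts at the
-- successor, without truncated subtraction.
segment-split : ∀ (v : ℕ → A) i k l →
  segment v i (suc k + l) ≡ segment v i (suc k) ++ segment v (suc (i + k)) l
segment-split v i zero    l = cong (λ j → v i ∷ segment v (suc j) l) (sym (+-identityʳ i))
segment-split v i (suc k) l = cong (v i ∷_) (trans (segment-split v (suc i) k l)
  (cong (λ j → segment v (suc i) (suc k) ++ segment v (suc j) l) (sym (+-suc i k))))

segment-shift : ∀ (v : ℕ → A) i k → segment v (suc i) k ≡ segment (λ j → v (suc j)) i k
segment-shift v i zero    = refl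
segment-shift v i (suc k) = cong (v (suc i) ∷_) (segment-shift v (suc i) k)

∈-segment : ∀ (v : ℕ → A) i k {x} → x ∈ segment v i k → ∃ λ j → j < k × v (i + j) ≡ x
∈-segment v i (suc k) (here refl) = 0 , z<s , cong v (+-identityʳ i)
∈-segment v i (suc k) (there x∈) with j , j<k , eq ← ∈-segment v (suc i) k x∈ =
  suc j , s≤s j<k , trans (cong v (+-suc i j)) eq

-- The default `d` makes a list a total sequence, so that path vertices can be indexed by natural
-- numbers.
nth : A → List A → ℕ → A
nth d []       _       = d
nth d (x ∷ xs) zero    = x
nth d (x ∷ xs) (suc i) = nth d xs i

segment-nth : ∀ (d : A) xs → segment (nth d xs) 0 (length xs) ≡ xs
segment-nth d []       = refl
segment-nth d (x ∷ xs) =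
  cong (x ∷_) (trans (segment-shift (nth d (x ∷ xs)) 0 (length xs)) (segment-nth d xs))

nth-∈ : ∀ (d : A) xs {i} → i < length xs → nth d xs i ∈ xs
nth-∈ d (x ∷ xs) {zero}  _         = here refl
nth-∈ d (x ∷ xs) {suc i} (s≤s i<k) = there (nth-∈ d xs i<k)

nth-injective : ∀ (d : A) {xs} → Unique xs → ∀ {i j} → i < length xs → j < length xs →
  nth d xs i ≡ nth d xs j → i ≡ j
nth-injective d {x ∷ xs} (x∉ ∷ u) {zero}  {zero}  _ _ _ = refl
nth-injective d {x ∷ xs} (x∉ ∷ u) {zero}  {suc j} _ (s≤s j<) eq =
  contradiction eq (All.lookup x∉ (nth-∈ d xs j<))
nth-injective d {x ∷ xs} (x∉ ∷ u) {suc i} {zero}  (s≤s i<) _ eq =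
  contradiction (sym eq) (All.lookup x∉ (nth-∈ d xs i<))
nth-injective d {x ∷ xs} (x∉ ∷ u) {suc i} {suc j} (s≤s i<) (s≤s j<) eq =
  cong suc (nth-injective d u i< j< eq)

module _ {D : Digraph n} where

  nth-arc : ∀ d {xs} → Walk D xs → ∀ {i} → suc i < length xs → nth d xs i ⟶[ D ] nth d xs (suc i)
  nth-arc d (step x y xs a w) {zero}  _         = a
  nth-arc d (step x y xs a w) {suc i} (s≤s lt)  = nth-arc d w lt
  nth-arc d (single x)        {i}     (s≤s ())

  -- `v (i + k)` is the last vertex of the block, so a single extra arc glues the block to any walk.
  walk-join : ∀ (v : ℕ → Fin n) i k {y ys} →
    (∀ {j} → j < i + k → v j ⟶[ D ] v (suc j)) → v (i + k) ⟶[ D ] y →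
    Walk D (y ∷ ys) → Walk D (segment v i (suc k) ++ y ∷ ys)
  walk-join v i zero    {y} {ys} arc a w =
    step (v i) y ys (subst (λ j → v j ⟶[ D ] y) (+-identityʳ i) a) w
  walk-join v i (suc k) {y} {ys} arc a w =
    step (v i) (v (suc i)) (segment v (suc (suc i)) k ++ y ∷ ys) (arc (m<m+n i z<s))
      (walk-join v (suc i) k (λ {j} lt → arc (subst (j <_) (sym (+-suc i k)) lt))
        (subst (λ j → v j ⟶[ D ] y) (+-suc i k) a) w)

  walk-segment : ∀ (v : ℕ → Fin n) i k → (∀ {j} → j < i + k → v j ⟶[ D ] v (suc j)) →
    Walk D (segment v i (suc k))
  walk-segment v i zero    arc = single (v i)
  walk-segment v i (suc k) arc = step (v i) (v (suc i)) _ (arc (m<m+n i z<s))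
    (walk-segment v (suc i) k λ {j} lt → arc (subst (j <_) (sym (+-suc i k)) lt))

last-++ : ∀ (xs : List A) y ys → last (xs ++ y ∷ ys) ≡ last (y ∷ ys)
last-++ []            y ys = refl
last-++ (x ∷ [])      y ys = refl
last-++ (x ∷ z ∷ xs)  y ys = last-++ (z ∷ xs) y ys

-- Deciding extendability by finite search

walk? : ∀ (D : Digraph n) xs → Dec (Walk D xs)
walk? D []           = no λ ()
walk? D (x ∷ [])     = yes (single x)
walk? D (x ∷ y ∷ xs) = map′ (λ (a , w) → step x y xs a w) (λ { (step _ _ _ a w) → a , w })
  (T? (D x y) ×-dec walk? D (y ∷ xs))

_⇔?_ : {B : Set} → Dec A → Dec B → Dec (A ⇔ B)
A? ⇔? B? = map′ (λ (f , g) → mk⇔ f g) (λ e → Equivalence.to e , Equivalence.from e)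
  ((A? →-dec B?) ×-dec (B? →-dec A?))

any-list? : ∀ {Q : List (Fin n) → Set} → (∀ xs → Dec (Q xs)) → ∀ k → Dec (∃ λ xs → length xs ≡ k × Q xs)
any-list? Q? zero    = map′ (λ q → [] , refl , q) (λ { ([] , refl , q) → q }) (Q? [])
any-list? Q? (suc k) = map′ (λ (x , xs , eq , q) → x ∷ xs , cong suc eq , q)
  (λ { (x ∷ xs , refl , q) → x , xs , refl , q })
  (Fin.any? λ x → any-list? (λ xs → Q? (x ∷ xs)) k)

ExtendedBy : Digraph n → List (Fin n) → List (Fin n) → Fin n → Set
ExtendedBy D P P′ w = IsPath D P′ × head P′ ≡ head P × last P′ ≡ last P ×
  ¬ (w ∈ P) × (∀ x → (x ∈ P′) ⇔ (x ∈ P ⊎ x ≡ w))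

extendedBy? : ∀ (D : Digraph n) P P′ w → Dec (ExtendedBy D P P′ w)
extendedBy? D P P′ w = (walk? D P′ ×-dec unique? Fin._≟_ P′)
  ×-dec ≡-dec Fin._≟_ (head P′) (head P) ×-dec ≡-dec Fin._≟_ (last P′) (last P)
  ×-dec ¬? (w ∈ₚ? P) ×-dec Fin.all? λ x → (x ∈ₚ? P′) ⇔? ((x ∈ₚ? P) ⊎-dec (x Fin.≟ w))
  where _∈ₚ?_ = _∈?_ Fin._≟_

-- An extension has exactly one more vertex, so a search over the lists of that length decides.
extendable-by-contradiction : ∀ {D : Digraph n} {P} →
  ((∀ P′ w → ExtendedBy D P P′ w → length P′ ≢ suc (length P)) → Extendable D P) → Extendable D P
extendable-by-contradiction {D = D} {P} k
  with any-list? (λ P′ → Fin.any? (extendedBy? D P P′)) (suc (length P))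
... | yes (P′ , _ , w , e) = P′ , w , e
... | no none              = k λ P′ w e eq → none (P′ , eq , w , e)

-- Distinctness, vertex set and length are invariant under permutation, so an exchange only has to
-- exhibit a walk with the right ends that rearranges `w ∷ P`.
extendedBy-permutation : ∀ {D : Digraph n} {P P′ w} → P′ ↭ w ∷ P → Unique P → w ∉ P →
  Walk D P′ → head P′ ≡ head P → last P′ ≡ last P → ExtendedBy D P P′ w × length P′ ≡ suc (length P)
extendedBy-permutation {P = P} {P′} {w} P′↭wP u w∉P walk h l =
  ((walk , Permutationₛ.Unique-resp-↭ (setoid _) (↭⇒↭ₛ (↭-sym P′↭wP)) (¬Any⇒All¬ P w∉P ∷ u))
    , h , l , w∉P , λ x → mk⇔ (to x) (from x)) , ↭-length P′↭wP
  where
  to : ∀ x → x ∈ P′ → x ∈ P ⊎ x ≡ w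
  to x x∈ with ∈-resp-↭ P′↭wP x∈
  ... | here eq  = inj₂ eq
  ... | there x∈P = inj₁ x∈P
  from : ∀ x → x ∈ P ⊎ x ≡ w → x ∈ P′
  from x (inj₁ x∈P) = ∈-resp-↭ (↭-sym P′↭wP) (there x∈P)
  from x (inj₂ eq)  = ∈-resp-↭ (↭-sym P′↭wP) (here eq)

module Exchange {D : Digraph n} (r : ℕ) (v : ℕ → Fin n) (unique : Unique (segment v 0 (suc r)))
  (arc : ∀ {i} → i < r → v i ⟶[ D ] v (suc i))
  (maximal : ∀ P′ w → ExtendedBy D (segment v 0 (suc r)) P′ w → length P′ ≢ suc (length (segment v 0 (suc r))))
  where

  private
    _⟶_ : Fin n → Fin n → Set
    x ⟶ y = x ⟶[ D ] y

    no-extension : ∀ {P′ w} → P′ ↭ w ∷ segment v 0 (suc r) → w ∉ segment v 0 (suc r) →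
      Walk D P′ → head P′ ≡ head (segment v 0 (suc r)) → ¬ last P′ ≡ last (segment v 0 (suc r))
    no-extension {P′} {w} p w∉ walk h l
      with e , len ← extendedBy-permutation p unique w∉ walk h l = maximal P′ w e len

    arc< : ∀ {k} → k ≤ r → ∀ {i} → i < k → v i ⟶ v (suc i)
    arc< k≤r i<k = arc (≤-trans i<k k≤r)

    gap : ∀ {i j} → i < j → ∃ λ α → suc i + α ≡ j
    gap lt = m≤n⇒∃[o]m+o≡n lt

    module Perm {A : Set} = CommutativeMonoidSolver (++-commutativeMonoid {A = A})

    -- The block after the cut `i` up to the next cut `suc i + α`. Matching on `gap` brings every
    -- later cut into this form.
    rest : ℕ → ℕ → List (Fin n)
    rest i α = segment v (suc i) (suc α)

    split : ∀ i α l → segment v (suc i) (suc α + l) ≡ rest i α ++ segment v (suc (suc i + α)) l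
    split i α l = segment-split v (suc i) α l

  no-insertion : ∀ {i w} → i < r → w ∉ segment v 0 (suc r) → v i ⟶ w → ¬ w ⟶ v (suc i)
  no-insertion {i} {w} i<r w∉ iw wi with gap i<r
  ... | α , refl = no-extension perm w∉
      (walk-join v 0 i (arc< (<⇒≤ i<r)) iw (step w _ _ wi (walk-segment v (suc i) α arc)))
      refl (trans (last-++ (segment v 0 (suc i)) w _)
        (sym (trans (cong last P≡) (last-++ (segment v 0 (suc i)) _ _))))
    where
    P≡ : segment v 0 (suc (suc i + α)) ≡ segment v 0 (suc i) ++ rest i α
    P≡ = trans (cong (segment v 0) (sym (+-suc (suc i) α))) (segment-split v 0 i (suc α))
    perm : segment v 0 (suc i) ++ w ∷ rest i α ↭ w ∷ segment v 0 (suc (suc i + α))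
    perm = ↭-trans (Perm.solve 3 (λ a b c → a Perm.⊕ (b Perm.⊕ c) Perm.⊜ b Perm.⊕ (a Perm.⊕ c)) (↭-reflexive refl)
        (segment v 0 (suc i)) (w ∷ []) (rest i α))
      (↭-reflexive (cong (w ∷_) (sym P≡)))

  -- The longer path would be `v 0` ... `v i`, `v (j + 1)` ... `v k`, `w`, `v (i + 1)` ... `v j`,
  -- `v (k + 1)` ... `v r`.
  no-swap : ∀ {i j k w} → i < j → j < k → k < r → w ∉ segment v 0 (suc r) →
    v i ⟶ v (suc j) → v j ⟶ v (suc k) → v k ⟶ w → ¬ w ⟶ v (suc i)
  no-swap {i} {j} {k} {w} i<j j<k k<r w∉ ij jk kw wi with gap i<j | gap j<k | gap k<r
  ... | α , refl | β , refl | γ , refl = no-extension perm w∉ walk refl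
      (trans (last-++ X _ _) (trans (last-++ Z _ _) (trans (last-++ (w ∷ Y) _ _)
        (sym (trans (cong last P≡) (trans (last-++ X _ _) (trans (last-++ Y _ _) (last-++ Z _ _))))))))
    where
    X = segment v 0 (suc i)
    Y = rest i α
    Z = rest j β
    W = rest k γ
    P≡ : segment v 0 (suc r) ≡ X ++ Y ++ Z ++ W
    P≡ = begin
      segment v 0 (suc (suc k + γ))           ≡⟨ cong (segment v 0) (lengths i α β γ) ⟩
      segment v 0 (suc i + (suc α + (suc β + suc γ))) ≡⟨ segment-split v 0 i _ ⟩
      X ++ segment v (suc i) (suc α + (suc β + suc γ)) ≡⟨ cong (X ++_) (split i α _) ⟩
      X ++ Y ++ segment v (suc j) (suc β + suc γ) ≡⟨ cong (λ zs → X ++ Y ++ zs) (split j β _) ⟩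
      X ++ Y ++ Z ++ W ∎
      where
      open ≡-Reasoning
      lengths : ∀ i α β γ → suc (suc (suc (suc i + α) + β) + γ) ≡ suc i + (suc α + (suc β + suc γ))
      lengths = solve-∀
    walk : Walk D (X ++ Z ++ w ∷ Y ++ W)
    walk = walk-join v 0 i (arc< (<⇒≤ (<-trans i<j (<-trans j<k k<r)))) ij
      (walk-join v (suc j) β (arc< (<⇒≤ k<r)) kw
      (step w _ _ wi (walk-join v (suc i) α (arc< (<⇒≤ (<-trans j<k k<r))) jk
      (walk-segment v (suc k) γ arc))))
    perm : X ++ Z ++ w ∷ Y ++ W ↭ w ∷ segment v 0 (suc r)
    perm = ↭-trans (Perm.solve 5 (λ x y z w′ u → x Perm.⊕ (z Perm.⊕ (u Perm.⊕ (y Perm.⊕ w′)))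
        Perm.⊜ u Perm.⊕ (x Perm.⊕ (y Perm.⊕ (z Perm.⊕ w′)))) (↭-reflexive refl) X Y Z W (w ∷ []))
      (↭-reflexive (cong (w ∷_) (sym P≡)))

  -- The four blocks between the five cuts would be visited in the opposite order, each still run
  -- forwards, with `w` inserted in the middle.
  no-reversal : ∀ {i j k l o w} → i < j → j < k → k < l → l < o → o < r → w ∉ segment v 0 (suc r) →
    v i ⟶ v (suc l) → v o ⟶ v (suc k) → v l ⟶ w → w ⟶ v (suc j) → v k ⟶ v (suc i) →
    ¬ v j ⟶ v (suc o)
  no-reversal {i} {j} {k} {l} {o} {w} i<j j<k k<l l<o o<r w∉ il ok lw wj ki jo
    with gap i<j | gap j<k | gap k<l | gap l<o | gap o<r
  ... | α , refl | β , refl | γ , refl | δ , refl | ε , refl = no-extension perm w∉ walk refl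
      (trans (last-++ X _ _) (trans (last-++ Y₄ _ _) (trans (last-++ Y₃ _ _) (trans (last-++ (w ∷ Y₂) _ _)
        (trans (last-++ Y₁ _ _)
        (sym (trans (cong last P≡) (trans (last-++ X _ _) (trans (last-++ Y₁ _ _) (trans (last-++ Y₂ _ _)
          (trans (last-++ Y₃ _ _) (last-++ Y₄ _ _))))))))))))
    where
    X = segment v 0 (suc i)
    Y₁ = rest i α
    Y₂ = rest j β
    Y₃ = rest k γ
    Y₄ = rest l δ
    W = rest o ε
    P≡ : segment v 0 (suc r) ≡ X ++ Y₁ ++ Y₂ ++ Y₃ ++ Y₄ ++ W
    P≡ = begin
      segment v 0 (suc (suc o + ε)) ≡⟨ cong (segment v 0) (lengths i α β γ δ ε) ⟩
      segment v 0 (suc i + (suc α + (suc β + (suc γ + (suc δ + suc ε))))) ≡⟨ segment-split v 0 i _ ⟩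
      X ++ segment v (suc i) (suc α + (suc β + (suc γ + (suc δ + suc ε)))) ≡⟨ cong (X ++_) (split i α _) ⟩
      X ++ Y₁ ++ segment v (suc j) (suc β + (suc γ + (suc δ + suc ε)))
        ≡⟨ cong (λ zs → X ++ Y₁ ++ zs) (split j β _) ⟩
      X ++ Y₁ ++ Y₂ ++ segment v (suc k) (suc γ + (suc δ + suc ε))
        ≡⟨ cong (λ zs → X ++ Y₁ ++ Y₂ ++ zs) (split k γ _) ⟩
      X ++ Y₁ ++ Y₂ ++ Y₃ ++ segment v (suc l) (suc δ + suc ε)
        ≡⟨ cong (λ zs → X ++ Y₁ ++ Y₂ ++ Y₃ ++ zs) (split l δ _) ⟩
      X ++ Y₁ ++ Y₂ ++ Y₃ ++ Y₄ ++ W ∎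
      where
      open ≡-Reasoning
      lengths : ∀ i α β γ δ ε → suc (suc (suc (suc (suc (suc i + α) + β) + γ) + δ) + ε)
        ≡ suc i + (suc α + (suc β + (suc γ + (suc δ + suc ε))))
      lengths = solve-∀
    o≤r = <⇒≤ o<r
    l≤r = ≤-trans (<⇒≤ l<o) o≤r
    k≤r = ≤-trans (<⇒≤ k<l) l≤r
    j≤r = ≤-trans (<⇒≤ j<k) k≤r
    walk : Walk D (X ++ Y₄ ++ Y₃ ++ w ∷ Y₂ ++ Y₁ ++ W)
    walk = walk-join v 0 i (arc< (≤-trans (<⇒≤ i<j) j≤r)) il
      (walk-join v (suc l) δ (arc< o≤r) ok
      (walk-join v (suc k) γ (arc< l≤r) lw
      (step w _ _ wj (walk-join v (suc j) β (arc< k≤r) ki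
      (walk-join v (suc i) α (arc< j≤r) jo
      (walk-segment v (suc o) ε arc))))))
    perm : X ++ Y₄ ++ Y₃ ++ w ∷ Y₂ ++ Y₁ ++ W ↭ w ∷ segment v 0 (suc r)
    perm = ↭-trans (Perm.solve 7 (λ x a b c d e u →
        x Perm.⊕ (d Perm.⊕ (c Perm.⊕ (u Perm.⊕ (b Perm.⊕ (a Perm.⊕ e)))))
        Perm.⊜ u Perm.⊕ (x Perm.⊕ (a Perm.⊕ (b Perm.⊕ (c Perm.⊕ (d Perm.⊕ e))))))
        (↭-reflexive refl) X Y₁ Y₂ Y₃ Y₄ W (w ∷ []))
      (↭-reflexive (cong (w ∷_) (sym P≡)))

-- Finite sums of indicators

⟦_⟧ : Bool → ℕ
⟦ false ⟧ = 0
⟦ true ⟧  = 1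

⟦⟧≡1 : ∀ {b} → T b → ⟦ b ⟧ ≡ 1
⟦⟧≡1 {true} _ = refl

⟦⟧≡0 : ∀ {b} → ¬ T b → ⟦ b ⟧ ≡ 0
⟦⟧≡0 {false} _ = refl
⟦⟧≡0 {true}  f = contradiction _ f

⟦⟧≤1 : ∀ b → ⟦ b ⟧ ≤ 1
⟦⟧≤1 false = z≤n
⟦⟧≤1 true  = ≤-refl

⟦∧⟧ : ∀ b c → ⟦ b ∧ c ⟧ ≡ ⟦ b ⟧ * ⟦ c ⟧
⟦∧⟧ false c = refl
⟦∧⟧ true  c = sym (+-identityʳ ⟦ c ⟧)

δ : Fin n → Fin n → ℕ
δ i j = ⟦ does (i Fin.≟ j) ⟧

δ-refl : ∀ (i : Fin n) → δ i i ≡ 1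
δ-refl i = cong ⟦_⟧ (dec-true (i Fin.≟ i) refl)

δ-≢ : ∀ {i j : Fin n} → i ≢ j → δ i j ≡ 0
δ-≢ {i = i} {j} i≢j = cong ⟦_⟧ (dec-false (i Fin.≟ j) i≢j)

sum-mono : ∀ {f g : Fin k → ℕ} → (∀ i → f i ≤ g i) → sum f ≤ sum g
sum-mono {zero}  f≤g = z≤n
sum-mono {suc k} f≤g = +-mono-≤ (f≤g zero) (sum-mono (f≤g ∘ suc))

sum-zero : ∀ {f : Fin k → ℕ} → (∀ i → f i ≡ 0) → sum f ≡ 0
sum-zero {zero}  f≡0 = refl
sum-zero {suc k} f≡0 = cong₂ _+_ (f≡0 zero) (sum-zero (f≡0 ∘ suc))

sum-δ : ∀ (j : Fin k) (f : Fin k → ℕ) → sum (λ i → δ j i * f i) ≡ f j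
sum-δ zero    f = trans (cong (f zero + 0 +_) (sum-zero {f = λ i → δ zero (suc i) * f (suc i)} λ _ → refl))
  (trans (+-identityʳ _) (+-identityʳ _))
sum-δ (suc j) f = trans (sum-cong-≗ (λ i → cong (_* f (suc i)) (δ-suc j i))) (sum-δ j (f ∘ suc))
  where
  δ-suc : ∀ {k} (j i : Fin k) → δ (suc j) (suc i) ≡ δ j i
  δ-suc j i with j Fin.≟ i
  ... | yes _ = refl
  ... | no _  = refl

sum-δ-1 : ∀ (j : Fin k) → sum (δ j) ≡ 1
sum-δ-1 j = trans (sum-cong-≗ (λ i → sym (*-identityʳ (δ j i)))) (sum-δ j (λ _ → 1))

term≤sum : ∀ (f : Fin k → ℕ) j → f j ≤ sum f
term≤sum f zero    = m≤m+n _ _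
term≤sum f (suc j) = ≤-trans (term≤sum (f ∘ suc) j) (m≤n+m _ _)

sum-mono-< : ∀ {f g : Fin k → ℕ} → (∀ i → f i ≤ g i) → ∀ j → f j < g j → sum f < sum g
sum-mono-< {suc k} f≤g zero    lt = +-mono-<-≤ lt (sum-mono (f≤g ∘ suc))
sum-mono-< {suc k} f≤g (suc j) lt = +-mono-≤-< (f≤g zero) (sum-mono-< (f≤g ∘ suc) j lt)

sum-positive : ∀ (f : Fin k → ℕ) → 1 ≤ sum f → ∃ λ i → 1 ≤ f i
sum-positive {suc k} f 1≤ with f zero in eq
... | suc _ = zero , subst (1 ≤_) (sym eq) (s≤s z≤n)
... | zero with i , 1≤i ← sum-positive (f ∘ suc) 1≤ = suc i , 1≤i

sum-const-1 : ∀ k → sum {k} (λ _ → 1) ≡ k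
sum-const-1 zero    = refl
sum-const-1 (suc k) = cong suc (sum-const-1 k)

countV≡sum : ∀ (p : Fin n → Bool) → countV p ≡ sum (λ x → ⟦ p x ⟧)
countV≡sum p = go (λ i → i)
  where
  go : ∀ {k} (f : Fin k → Fin _) → length (filter (λ x → T? (p x)) (tabulate f)) ≡ sum (λ i → ⟦ p (f i) ⟧)
  go {zero}  f = refl
  go {suc k} f with p (f zero)
  ... | true  = cong suc (go (f ∘ suc))
  ... | false = go (f ∘ suc)

∑< : ℕ → (ℕ → ℕ) → ℕ
∑< k f = sum {k} (f ∘ toℕ)

∑<-last : ∀ k f → ∑< (suc k) f ≡ ∑< k f + f k
∑<-last zero    f = +-identityʳ (f 0)
∑<-last (suc k) f = trans (cong (f 0 +_) (∑<-last k (f ∘ suc))) (sym (+-assoc (f 0) _ _))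

∑<-mono : ∀ {k f g} → (∀ {i} → i < k → f i ≤ g i) → ∑< k f ≤ ∑< k g
∑<-mono f≤g = sum-mono λ i → f≤g (Fin.toℕ<n i)

∑<-cong : ∀ {k f g} → (∀ {i} → i < k → f i ≡ g i) → ∑< k f ≡ ∑< k g
∑<-cong f≡g = sum-cong-≗ λ i → f≡g (Fin.toℕ<n i)

∑<-mono-< : ∀ {k f g} → (∀ {i} → i < k → f i ≤ g i) → ∀ {j} → j < k → f j < g j → ∑< k f < ∑< k g
∑<-mono-< {f = f} {g} f≤g j<k lt = sum-mono-< (λ i → f≤g (Fin.toℕ<n i)) (fromℕ< j<k)
  (subst (λ j → f j < g j) (sym (Fin.toℕ-fromℕ< j<k)) lt)

δℕ : ℕ → ℕ → ℕ
δℕ i j = ⟦ does (i ≟ j) ⟧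

δℕ-refl : ∀ i → δℕ i i ≡ 1
δℕ-refl i = cong ⟦_⟧ (dec-true (i ≟ i) refl)

δℕ-≢ : ∀ {i j} → i ≢ j → δℕ i j ≡ 0
δℕ-≢ {i} {j} i≢j = cong ⟦_⟧ (dec-false (i ≟ j) i≢j)

∑<-δℕ : ∀ {j k} → j < k → ∑< k (δℕ j) ≡ 1
∑<-δℕ {j} {k} j<k = trans (sum-cong-≗ pointwise) (sum-δ-1 (fromℕ< j<k))
  where
  pointwise : ∀ i → δℕ j (toℕ i) ≡ δ (fromℕ< j<k) i
  pointwise i with fromℕ< j<k Fin.≟ i
  ... | yes refl = trans (cong (δℕ j) (Fin.toℕ-fromℕ< j<k)) (δℕ-refl j)
  ... | no ne    = δℕ-≢ λ eq → ne (Fin.toℕ-injective (trans (Fin.toℕ-fromℕ< j<k) eq))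

below : ℕ → ℕ → ℕ
below t i = ⟦ does (i <? t) ⟧

below-< : ∀ {t i} → i < t → below t i ≡ 1
below-< {t} {i} lt = cong ⟦_⟧ (dec-true (i <? t) lt)

below-≥ : ∀ {t i} → t ≤ i → below t i ≡ 0
below-≥ {t} {i} le = cong ⟦_⟧ (dec-false (i <? t) (≤⇒≯ le))

∑<-below : ∀ {t k} → t ≤ k → ∑< k (below t) ≡ t
∑<-below {t} {k} t≤k with m≤n⇒∃[o]m+o≡n t≤k
... | o , refl = trans (extend o) (trans (∑<-cong {t} below-<) (sum-const-1 t))
  where
  extend : ∀ o → ∑< (t + o) (below t) ≡ ∑< t (below t)
  extend zero    = cong (λ k → ∑< k (below t)) (+-identityʳ t)
  extend (suc o) = trans (cong (λ k → ∑< k (below t)) (+-suc t o))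
    (trans (∑<-last (t + o) (below t))
      (trans (cong₂ _+_ (extend o) (below-≥ (m≤m+n t o))) (+-identityʳ _)))

∑<-+ : ∀ k f g → ∑< k (λ i → f i + g i) ≡ ∑< k f + ∑< k g
∑<-+ k f g = ∑-distrib-+ {k} (f ∘ toℕ) (g ∘ toℕ)

-- Pigeonhole: `f` is at most 1, lives on indices below `t` and vanishes at two of them. The bound
-- at `l = i` also forces `i` and `j` to differ.
∑<-except-two : ∀ {k t i j} f → t ≤ k → i < k → j < k →
  (∀ {l} → l < k → f l + (δℕ i l + δℕ j l) ≤ below t l) → ∑< k f + 2 ≤ t
∑<-except-two {k} {t} {i} {j} f t≤k i<k j<k f≤ = begin
  ∑< k f + (1 + 1)                        ≡⟨ cong (∑< k f +_) (cong₂ _+_ (∑<-δℕ i<k) (∑<-δℕ j<k)) ⟨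
  ∑< k f + (∑< k (δℕ i) + ∑< k (δℕ j))    ≡⟨ cong (∑< k f +_) (∑<-+ k (δℕ i) (δℕ j)) ⟨
  ∑< k f + ∑< k (λ l → δℕ i l + δℕ j l)   ≡⟨ ∑<-+ k f (λ l → δℕ i l + δℕ j l) ⟨
  ∑< k (λ l → f l + (δℕ i l + δℕ j l))    ≤⟨ ∑<-mono {k} f≤ ⟩
  ∑< k (below t)                          ≡⟨ ∑<-below t≤k ⟩
  t                                       ∎
  where open ≤-Reasoning

∑<-extra-one : ∀ {k t i} f → t ≤ k → i < k →
  (∀ {l} → l < k → below t l + δℕ i l ≤ f l) → t + 1 ≤ ∑< k f
∑<-extra-one {k} {t} {i} f t≤k i<k ≤f = begin
  t + 1                                   ≡⟨ cong₂ _+_ (∑<-below t≤k) (∑<-δℕ i<k) ⟨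
  ∑< k (below t) + ∑< k (δℕ i)            ≡⟨ ∑<-+ k (below t) (δℕ i) ⟨
  ∑< k (λ l → below t l + δℕ i l)         ≤⟨ ∑<-mono {k} ≤f ⟩
  ∑< k f                                  ∎
  where open ≤-Reasoning

-- Two distinct zeros among `k` terms at most 1 would leave a sum of at most `k - 2`.
zero-term-unique : ∀ {k f} → (∀ {i} → i < k → f i ≤ 1) → suc (∑< k f) ≡ k →
  ∀ {i j} → i < k → j < k → f i ≡ 0 → f j ≡ 0 → i ≡ j
zero-term-unique {k} {f} f≤1 eq {i} {j} i<k j<k fi fj with i ≟ j
... | yes i≡j = i≡j
... | no i≢j = contradiction (∑<-except-two f ≤-refl i<k j<k pointwise) (<⇒≱ (≤-reflexive (trans (cong suc (sym eq)) (+-comm 2 (∑< k f)))))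
  where
  pointwise : ∀ {l} → l < k → f l + (δℕ i l + δℕ j l) ≤ below k l
  pointwise {l} l<k with i ≟ l | j ≟ l
  ... | yes refl | yes refl = contradiction refl i≢j
  ... | yes refl | no j≢l   = ≤-reflexive (trans (cong₂ _+_ fi (cong₂ _+_ (δℕ-refl i) (δℕ-≢ j≢l))) (sym (below-< l<k)))
  ... | no i≢l   | yes refl = ≤-reflexive (trans (cong₂ _+_ fj (cong₂ _+_ (δℕ-≢ i≢l) (δℕ-refl j))) (sym (below-< l<k)))
  ... | no i≢l   | no j≢l   = ≤-trans (≤-reflexive (trans (cong (f l +_) (cong₂ _+_ (δℕ-≢ i≢l) (δℕ-≢ j≢l))) (+-identityʳ (f l))))
    (≤-trans (f≤1 l<k) (≤-reflexive (sym (below-< l<k))))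

-- Arc counts in a tournament

module TournamentMatrix (b : Fin k → Fin k → ℕ) (complete : ∀ i j → b i j + b j i + δ i j ≡ 1) where

  weighted-arcs : (Fin k → ℕ) → ℕ
  weighted-arcs x = sum λ i → sum λ j → x i * x j * b i j

  -- In the square of `sum x`, each product `x i * x j` belongs to exactly one of the two possible
  -- arcs or to the diagonal. For a 0/1 weight this says that `k` vertices span `k (k - 1) / 2`
  -- arcs.
  weighted-arcs-total : ∀ x → 2 * weighted-arcs x + sum (λ i → x i * x i) ≡ sum x * sum x
  weighted-arcs-total x = sym (begin
    sum x * sum x
      ≡⟨ *-distribʳ-sum (sum x) x ⟩
    sum (λ i → x i * sum x)
      ≡⟨ sum-cong-≗ (λ i → *-distribˡ-sum (x i) x) ⟩
    sum (λ i → sum λ j → x i * x j)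
      ≡⟨ sum-cong-≗ (λ i → sum-cong-≗ λ j → pointwise i j) ⟩
    sum (λ i → sum λ j → (x i * x j * b i j + x j * x i * b j i) + δ i j * (x i * x j))
      ≡⟨ sum-cong-≗ (λ i → trans (∑-distrib-+ _ (λ j → δ i j * (x i * x j)))
           (cong₂ _+_ (∑-distrib-+ (λ j → x i * x j * b i j) _) (sum-δ i (λ j → x i * x j)))) ⟩
    sum (λ i → (sum (λ j → x i * x j * b i j) + sum (λ j → x j * x i * b j i)) + x i * x i)
      ≡⟨ trans (∑-distrib-+ _ (λ i → x i * x i)) (cong (_+ sum (λ i → x i * x i))
           (∑-distrib-+ (λ i → sum λ j → x i * x j * b i j) _)) ⟩
    weighted-arcs x + sum (λ i → sum λ j → x j * x i * b j i) + sum (λ i → x i * x i)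
      ≡⟨ cong (λ s → weighted-arcs x + s + sum (λ i → x i * x i)) (∑-comm λ i j → x j * x i * b j i) ⟩
    weighted-arcs x + weighted-arcs x + sum (λ i → x i * x i)
      ≡⟨ cong (λ s → weighted-arcs x + s + sum (λ i → x i * x i)) (+-identityʳ (weighted-arcs x)) ⟨
    2 * weighted-arcs x + sum (λ i → x i * x i) ∎)
    where
    open ≡-Reasoning
    rearrange : ∀ y z c d e → y * z * (c + d + e) ≡ y * z * c + z * y * d + e * (y * z)
    rearrange = solve-∀
    pointwise : ∀ i j → x i * x j ≡ x i * x j * b i j + x j * x i * b j i + δ i j * (x i * x j)
    pointwise i j = trans (sym (*-identityʳ (x i * x j)))
      (trans (cong (x i * x j *_) (sym (complete i j))) (rearrange (x i) (x j) (b i j) (b j i) (δ i j)))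

-- Non-extendable paths in regular tournaments

arcs-complete : ∀ {D : Digraph n} → IsTournament D → ∀ x y → ⟦ D x y ⟧ + ⟦ D y x ⟧ + δ x y ≡ 1
arcs-complete t x y with x Fin.≟ y
... | yes refl = cong₂ (λ b c → b + c + 1) (⟦⟧≡0 (irrefl x)) (⟦⟧≡0 (irrefl x))
  where open IsTournament t
... | no x≢y with IsTournament.total t x y x≢y
...   | inj₁ xy = trans (+-identityʳ _) (cong₂ _+_ (⟦⟧≡1 xy) (⟦⟧≡0 (IsTournament.asym t x y xy)))
...   | inj₂ yx = trans (+-identityʳ _) (cong₂ _+_ (⟦⟧≡0 (IsTournament.asym t y x yx)) (⟦⟧≡1 yx))

degree-sum : ∀ {D : Digraph n} → IsTournament D → ∀ x →
  sum (λ y → ⟦ D x y ⟧) + sum (λ y → ⟦ D y x ⟧) + 1 ≡ n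
degree-sum {n} {D} t x = begin
  sum (λ y → ⟦ D x y ⟧) + sum (λ y → ⟦ D y x ⟧) + 1
    ≡⟨ cong (sum (λ y → ⟦ D x y ⟧) + sum (λ y → ⟦ D y x ⟧) +_) (sum-δ-1 x) ⟨
  sum (λ y → ⟦ D x y ⟧) + sum (λ y → ⟦ D y x ⟧) + sum (δ x)
    ≡⟨ trans (∑-distrib-+ _ (δ x)) (cong (_+ sum (δ x)) (∑-distrib-+ (λ y → ⟦ D x y ⟧) _)) ⟨
  sum (λ y → ⟦ D x y ⟧ + ⟦ D y x ⟧ + δ x y)   ≡⟨ sum-cong-≗ (arcs-complete t x) ⟩
  sum {n} (λ _ → 1)                           ≡⟨ sum-const-1 n ⟩
  n                                           ∎
  where open ≡-Reasoning

-- v 0, …, v r is a path that cannot be extended, q marks the vertices off it, and m is the common degree.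
-- Non-extendability enters only through the exchanges excluded by no-insertion and no-swap: in this form
-- the whole configuration is invariant under reversing all arcs.
record Config {n : ℕ} (D : Digraph n) (v : ℕ → Fin n) (q : Fin n → Bool) (m r π : ℕ) : Set where
  field
    tournament   : IsTournament D
    outs         : ∀ x → sum (λ y → ⟦ D x y ⟧) ≡ m
    ins          : ∀ x → sum (λ y → ⟦ D y x ⟧) ≡ m
    injective    : ∀ {i j} → i ≤ r → j ≤ r → v i ≡ v j → i ≡ j
    off          : ∀ {w} → T (q w) → ∀ {i} → i ≤ r → v i ≢ w
    on           : ∀ {w} → ¬ T (q w) → ∃ λ i → i ≤ r × v i ≡ w
    arc          : ∀ {i} → i < r → v i ⟶[ D ] v (suc i)
    no-insertion : ∀ {i w} → i < r → T (q w) → v i ⟶[ D ] w → ¬ w ⟶[ D ] v (suc i)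
    no-swap      : ∀ {i j k w} → i < j → j < k → k < r → T (q w) →
      v i ⟶[ D ] v (suc j) → v j ⟶[ D ] v (suc k) → v k ⟶[ D ] w → ¬ w ⟶[ D ] v (suc i)
    two-paths    : ∀ {x y} → x ≢ y → π ≤ sum (λ z → ⟦ D x z ⟧ * ⟦ D z y ⟧)

-- In `no-swap` the cuts `i < j < k` become `r - k - 1 < r - j - 1 < r - i - 1`; the two arcs along
-- the path trade places, and so do the two arcs at `w`.
reverse : ∀ {D : Digraph n} {v q m r π} → Config D v q m r π →
  Config (flip D) (λ i → v (r ∸ i)) q m r π
reverse {D = D} {v} {q} {m} {r} {π} c = record
  { tournament   = record
    { irrefl = irrefl
    ; total  = λ x y x≢y → total y x (x≢y ∘ sym)
    ; asym   = λ x y → asym y x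
    }
  ; outs         = ins
  ; ins          = outs
  ; injective    = λ {i} {j} i≤r j≤r eq → ∸-cancelˡ-≡ i≤r j≤r (injective (m∸n≤m r i) (m∸n≤m r j) eq)
  ; off          = λ qw {i} _ → off qw (m∸n≤m r i)
  ; on           = λ ¬qw → let i , i≤r , eq = on ¬qw in
      r ∸ i , m∸n≤m r i , trans (cong v (m∸[m∸n]≡n i≤r)) eq
  ; arc          = λ {i} i<r → subst (λ x → v (r ∸ suc i) ⟶[ D ] x) (next i<r) (arc (below-r i<r))
  ; no-insertion = λ {i} {w} i<r qw wi iw → no-insertion (below-r i<r) qw iw
      (subst (λ x → w ⟶[ D ] x) (sym (next i<r)) wi)
  ; no-swap      = λ {i} {j} {k} {w} i<j j<k k<r qw ij jk kw wi →
      no-swap (∸-monoʳ-< (s≤s j<k) k<r) (∸-monoʳ-< (s≤s i<j) (<-trans j<k k<r)) (below-r (<-trans i<j (<-trans j<k k<r))) qw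
        (subst (λ x → v (r ∸ suc k) ⟶[ D ] x) (sym (next (<-trans j<k k<r))) jk)
        (subst (λ x → v (r ∸ suc j) ⟶[ D ] x) (sym (next (<-trans i<j (<-trans j<k k<r)))) ij)
        wi
        (subst (λ x → w ⟶[ D ] x) (sym (next k<r)) kw)
  ; two-paths    = λ {x} {y} x≢y → ≤-trans (two-paths (x≢y ∘ sym))
      (≤-reflexive (sum-cong-≗ λ z → *-comm ⟦ D y z ⟧ ⟦ D z x ⟧))
  }
  where
  open Config c
  open IsTournament tournament
  below-r : ∀ {i} → i < r → r ∸ suc i < r
  below-r {i} i<r = ∸-monoʳ-< z<s i<r
  next : ∀ {i} → i < r → v (suc (r ∸ suc i)) ≡ v (r ∸ i)
  next {i} i<r = cong v (sym (+-∸-assoc 1 i<r))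

-- Threshold structure and degree identities

module Facts {D : Digraph n} {v q m r π} (c : Config D v q m r π) where
  open Config c public
  open IsTournament tournament public

  infix 4 _⟶_
  _⟶_ : Fin n → Fin n → Set
  x ⟶ y = x ⟶[ D ] y

  a : Fin n → Fin n → ℕ
  a x y = ⟦ D x y ⟧

  o : Fin n → ℕ
  o w = ⟦ q w ⟧

  ¬arc⇒arc : ∀ {x y} → x ≢ y → ¬ x ⟶ y → y ⟶ x
  ¬arc⇒arc {x} {y} x≢y ¬xy with total x y x≢y
  ... | inj₁ xy = contradiction xy ¬xy
  ... | inj₂ yx = yx

  v-≢ : ∀ {i j} → i ≤ r → j ≤ r → i ≢ j → v i ≢ v j
  v-≢ i≤r j≤r i≢j = i≢j ∘ injective i≤r j≤r

  enters : ∀ {w i} → T (q w) → i ≤ r → ¬ w ⟶ v i → v i ⟶ w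
  enters qw i≤r = ¬arc⇒arc (off qw i≤r ∘ sym)

  leaves : ∀ {w i} → T (q w) → i ≤ r → ¬ v i ⟶ w → w ⟶ v i
  leaves qw i≤r = ¬arc⇒arc (off qw i≤r)

  -- `no-insertion` moves the arc back one vertex at a time: if `w` dominates `v (j + 1)`, then
  -- `v j` cannot dominate `w`.
  out-initial : ∀ {w i j} → T (q w) → i ≤ j → j ≤ r → w ⟶ v j → w ⟶ v i
  out-initial {w} {i} qw i≤j j≤r wj = go (≤⇒≤′ i≤j) j≤r wj
    where
    go : ∀ {j} → i ≤′ j → j ≤ r → w ⟶ v j → w ⟶ v i
    go ≤′-refl        j≤r wj = wj
    go (≤′-step i≤j) j<r wj =
      go i≤j (<⇒≤ j<r) (leaves qw (<⇒≤ j<r) λ jw → no-insertion j<r qw jw wj)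

  in-final : ∀ {w i j} → T (q w) → i ≤ j → j ≤ r → v i ⟶ w → v j ⟶ w
  in-final qw i≤j j≤r iw = enters qw j≤r λ wj → asym _ _ iw (out-initial qw i≤j j≤r wj)

  order : n ≡ suc (2 * m)
  order = begin
    n                                              ≡⟨ degree-sum tournament (v 0) ⟨
    sum (a (v 0)) + sum (λ y → a y (v 0)) + 1      ≡⟨ cong (_+ 1) (cong₂ _+_ (outs (v 0)) (ins (v 0))) ⟩
    m + m + 1                                      ≡⟨ twice m ⟩
    suc (2 * m)                                    ∎
    where
    open ≡-Reasoning
    twice : ∀ m → m + m + 1 ≡ suc (2 * m)
    twice = solve-∀

  -- As a sum of unit vectors, the indicator converts sums over vertices of the path into sums over
  -- indices; injectivity of `v` keeps each vertex from being counted twice.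
  on-path-indicator : ∀ w → ⟦ not (q w) ⟧ ≡ ∑< (suc r) (λ i → δ (v i) w)
  on-path-indicator w with q w in eq
  ... | true  = sym (sum-zero λ i → δ-≢ (off (subst T (sym eq) tt) (≤-pred (Fin.toℕ<n i))))
  ... | false with on (subst T eq)
  ...   | j , j≤r , refl = sym (trans (∑<-cong pointwise) (∑<-δℕ (s≤s j≤r)))
    where
    pointwise : ∀ {i} → i < suc r → δ (v i) (v j) ≡ δℕ j i
    pointwise {i} i<p with i ≟ j
    ... | yes refl = trans (δ-refl (v i)) (sym (δℕ-refl i))
    ... | no i≢j   = trans (δ-≢ (v-≢ (≤-pred i<p) j≤r i≢j)) (sym (δℕ-≢ (i≢j ∘ sym)))

  sum-on-path : ∀ f → sum (λ w → ⟦ not (q w) ⟧ * f w) ≡ ∑< (suc r) (f ∘ v)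
  sum-on-path f = begin
    sum (λ w → ⟦ not (q w) ⟧ * f w)
      ≡⟨ sum-cong-≗ (λ w → trans (cong (_* f w) (on-path-indicator w))
           (*-distribʳ-sum (f w) (λ i → δ (v (toℕ {suc r} i)) w))) ⟩
    sum (λ w → ∑< (suc r) λ i → δ (v i) w * f w)
      ≡⟨ ∑-comm (λ w i → δ (v (toℕ {suc r} i)) w * f w) ⟩
    ∑< (suc r) (λ i → sum λ w → δ (v i) w * f w)
      ≡⟨ ∑<-cong {suc r} (λ {i} _ → sum-δ (v i) f) ⟩
    ∑< (suc r) (f ∘ v) ∎
    where open ≡-Reasoning

  sum-split-on : ∀ f → sum f ≡ sum (λ w → ⟦ not (q w) ⟧ * f w) + sum (λ w → o w * f w)
  sum-split-on f = trans (sum-cong-≗ pointwise) (∑-distrib-+ (λ w → ⟦ not (q w) ⟧ * f w) _)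
    where
    pointwise : ∀ w → f w ≡ ⟦ not (q w) ⟧ * f w + o w * f w
    pointwise w with q w
    ... | true  = sym (+-identityʳ (f w))
    ... | false = sym (trans (+-identityʳ (f w + 0)) (+-identityʳ (f w)))

  sum-split : ∀ f → sum f ≡ ∑< (suc r) (f ∘ v) + sum (λ w → o w * f w)
  sum-split f = trans (sum-split-on f) (cong (_+ sum (λ w → o w * f w)) (sum-on-path f))

  -- Indicator of the vertices off the path whose threshold is neither 0 nor r + 1.
  mixed : Fin n → ℕ
  mixed w = o w * (a w (v 0) * a (v r) w)

  out-on-path : ℕ → ℕ
  out-on-path b = ∑< (suc r) λ i → a (v b) (v i)

  in-on-path : ℕ → ℕ
  in-on-path b = ∑< (suc r) λ i → a (v i) (v b)

  -- `v b` and `v 0` have equal out-degrees. Off the path, `v b` dominates everything that `v 0`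
  -- dominates, nothing with threshold `r + 1`, and otherwise just the mixed vertices counted here.
  mixed-out-degree : ∀ {b} → b ≤ r →
    out-on-path b + sum (λ w → mixed w * a (v b) w) ≡ out-on-path 0
  mixed-out-degree {b} b≤r = +-cancelʳ-≡ N₀ _ _ (begin
    out-on-path b + sum (λ w → mixed w * a (v b) w) + N₀
      ≡⟨ trans (+-assoc (out-on-path b) _ N₀) (cong (out-on-path b +_) (+-comm _ N₀)) ⟩
    out-on-path b + (N₀ + sum (λ w → mixed w * a (v b) w))
      ≡⟨ cong (out-on-path b +_) (∑-distrib-+ (λ w → o w * a (v 0) w) _) ⟨
    out-on-path b + sum (λ w → o w * a (v 0) w + mixed w * a (v b) w)
      ≡⟨ cong (out-on-path b +_) (sum-cong-≗ pointwise) ⟨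
    out-on-path b + sum (λ w → o w * a (v b) w)
      ≡⟨ sum-split (a (v b)) ⟨
    sum (a (v b)) ≡⟨ trans (outs (v b)) (sym (outs (v 0))) ⟩
    sum (a (v 0)) ≡⟨ sum-split (a (v 0)) ⟩
    out-on-path 0 + N₀ ∎)
    where
    open ≡-Reasoning
    N₀ = sum (λ w → o w * a (v 0) w)
    pointwise : ∀ w → o w * a (v b) w ≡ o w * a (v 0) w + mixed w * a (v b) w
    pointwise w with T? (q w)
    ... | no ¬qw rewrite ⟦⟧≡0 ¬qw = refl
    ... | yes qw with T? (D (v 0) w)
    ...   | yes 0w rewrite ⟦⟧≡1 qw | ⟦⟧≡1 0w | ⟦⟧≡1 (in-final qw z≤n b≤r 0w)
                         | ⟦⟧≡0 (asym (v 0) w 0w) = refl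
    ...   | no ¬0w with T? (D (v r) w)
    ...     | yes rw rewrite ⟦⟧≡1 qw | ⟦⟧≡0 ¬0w | ⟦⟧≡1 (leaves qw z≤n ¬0w) | ⟦⟧≡1 rw = refl
    ...     | no ¬rw rewrite ⟦⟧≡1 qw | ⟦⟧≡0 ¬0w | ⟦⟧≡0 ¬rw
                           | ⟦⟧≡0 (asym w (v b) (out-initial qw b≤r ≤-refl (leaves qw ≤-refl ¬rw)))
                           | *-zeroʳ (a w (v 0)) = refl

  -- A vertex off the path is dominated by `v 0`, or mixed, or dominates `v r`, and only one of
  -- these. Counting all `2 m + 1` vertices this way and comparing with the full degrees of the two
  -- ends leaves the path part.
  end-degrees : out-on-path 0 + in-on-path r ≡ r + sum mixed
  end-degrees = +-cancelʳ-≡ (N₀ + N₁ + 1) _ _ (begin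
    out-on-path 0 + in-on-path r + (N₀ + N₁ + 1)
      ≡⟨ regroup (out-on-path 0) (in-on-path r) N₀ N₁ ⟩
    suc ((out-on-path 0 + N₀) + (in-on-path r + N₁))
      ≡⟨ cong suc (cong₂ _+_ (trans (sym (sum-split (a (v 0)))) (outs (v 0)))
           (trans (sym (sum-split λ w → a w (v r))) (ins (v r)))) ⟩
    suc (m + m) ≡⟨ cong (λ k → suc (m + k)) (+-identityʳ m) ⟨
    suc (2 * m) ≡⟨ order ⟨
    n ≡⟨ trans (sym (sum-const-1 n)) (sum-split (λ _ → 1)) ⟩
    ∑< (suc r) (λ _ → 1) + sum (λ w → o w * 1)
      ≡⟨ cong₂ _+_ (sum-const-1 (suc r)) (sum-cong-≗ pointwise) ⟩
    suc r + sum (λ w → o w * a (v 0) w + (mixed w + o w * a w (v r)))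
      ≡⟨ cong (suc r +_) (trans (∑-distrib-+ (λ w → o w * a (v 0) w) _) (cong (N₀ +_) (∑-distrib-+ mixed _))) ⟩
    suc r + (N₀ + (sum mixed + N₁)) ≡⟨ regroup′ r N₀ (sum mixed) N₁ ⟩
    r + sum mixed + (N₀ + N₁ + 1) ∎)
    where
    open ≡-Reasoning
    N₀ = sum (λ w → o w * a (v 0) w)
    N₁ = sum (λ w → o w * a w (v r))
    regroup : ∀ x y z w → x + y + (z + w + 1) ≡ suc ((x + z) + (y + w))
    regroup = solve-∀
    regroup′ : ∀ x y z w → suc x + (y + (z + w)) ≡ x + z + (y + w + 1)
    regroup′ = solve-∀
    pointwise : ∀ w → o w * 1 ≡ o w * a (v 0) w + (mixed w + o w * a w (v r))
    pointwise w with T? (q w)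
    ... | no ¬qw rewrite ⟦⟧≡0 ¬qw = refl
    ... | yes qw with T? (D (v 0) w)
    ...   | yes 0w rewrite ⟦⟧≡1 qw | ⟦⟧≡1 0w | ⟦⟧≡0 (asym (v 0) w 0w)
                         | ⟦⟧≡0 (asym (v r) w (in-final qw z≤n ≤-refl 0w)) = refl
    ...   | no ¬0w with T? (D (v r) w)
    ...     | yes rw rewrite ⟦⟧≡1 qw | ⟦⟧≡0 ¬0w | ⟦⟧≡1 (leaves qw z≤n ¬0w) | ⟦⟧≡1 rw
                           | ⟦⟧≡0 (asym (v r) w rw) = refl
    ...     | no ¬rw rewrite ⟦⟧≡1 qw | ⟦⟧≡0 ¬0w | ⟦⟧≡0 ¬rw | ⟦⟧≡1 (leaves qw ≤-refl ¬rw)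
                           | *-zeroʳ (a w (v 0)) = refl

  -- Double counting of the arcs inside the path: there are `p (p - 1) / 2` of them, and
  -- `mixed-out-degree` expresses every path out-degree through that of `v 0`.
  arcs-on-path : 2 * (suc r * out-on-path 0) + suc r
    ≡ suc r * suc r + 2 * sum (λ w → mixed w * ∑< (suc r) (λ b → a (v b) w))
  arcs-on-path = begin
    2 * (p * out-on-path 0) + p
      ≡⟨ cong (λ k → 2 * k + p) (trans (cong (_* out-on-path 0) (sym (sum-const-1 p)))
           (*-distribʳ-sum (out-on-path 0) (λ (_ : Fin p) → 1))) ⟩
    2 * ∑< p (λ b → 1 * out-on-path 0) + p
      ≡⟨ cong (λ k → 2 * k + p) (∑<-cong {p} λ {b} b<p →
           trans (*-identityˡ _) (sym (mixed-out-degree (≤-pred b<p)))) ⟩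
    2 * ∑< p (λ b → out-on-path b + sum (λ w → mixed w * a (v b) w)) + p
      ≡⟨ cong (λ k → 2 * k + p) (trans (∑-distrib-+ {p} (out-on-path ∘ toℕ) (λ b → sum λ w → mixed w * a (v (toℕ b)) w))
           (cong (∑< p out-on-path +_) (trans (∑-comm (λ (b : Fin p) w → mixed w * a (v (toℕ b)) w))
             (sum-cong-≗ λ w → sym (*-distribˡ-sum (mixed w) (λ (b : Fin p) → a (v (toℕ b)) w)))))) ⟩
    2 * (∑< p out-on-path + X) + p
      ≡⟨ regroup (∑< p out-on-path) X p ⟩
    2 * ∑< p out-on-path + p + 2 * X
      ≡⟨ cong (λ k → 2 * k + p + 2 * X) (sum-cong-≗ {p} λ i → sum-cong-≗ {p} λ j →
           sym (*-identityˡ (a (v (toℕ i)) (v (toℕ j))))) ⟩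
    2 * M.weighted-arcs (λ _ → 1) + p + 2 * X
      ≡⟨ cong (λ k → 2 * M.weighted-arcs (λ _ → 1) + k + 2 * X) (sum-const-1 p) ⟨
    2 * M.weighted-arcs (λ _ → 1) + sum {p} (λ _ → 1) + 2 * X
      ≡⟨ cong (_+ 2 * X) (M.weighted-arcs-total (λ _ → 1)) ⟩
    sum {p} (λ _ → 1) * sum {p} (λ _ → 1) + 2 * X
      ≡⟨ cong (λ k → k * k + 2 * X) (sum-const-1 p) ⟩
    p * p + 2 * X ∎
    where
    open ≡-Reasoning
    p = suc r
    X = sum (λ w → mixed w * ∑< (suc r) (λ b → a (v b) w))
    regroup : ∀ x y z → 2 * (x + y) + z ≡ 2 * x + z + 2 * y
    regroup = solve-∀
    complete : ∀ (i j : Fin p) → a (v (toℕ i)) (v (toℕ j)) + a (v (toℕ j)) (v (toℕ i)) + δ i j ≡ 1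
    complete i j = trans (cong (a (v (toℕ i)) (v (toℕ j)) + a (v (toℕ j)) (v (toℕ i)) +_) same)
      (arcs-complete tournament (v (toℕ i)) (v (toℕ j)))
      where
      same : δ i j ≡ δ (v (toℕ i)) (v (toℕ j))
      same with i Fin.≟ j
      ... | yes refl = sym (δ-refl (v (toℕ i)))
      ... | no i≢j = sym (δ-≢ (v-≢ (≤-pred (Fin.toℕ<n i)) (≤-pred (Fin.toℕ<n j)) (i≢j ∘ Fin.toℕ-injective)))
    module M = TournamentMatrix (λ (i j : Fin p) → a (v (toℕ i)) (v (toℕ j))) complete

-- Vertices off the path with threshold at most 1 or at least r

module Shallow {D : Digraph n} {v q m s π} (c : Config D v q m (2+ s) π)
  (narrow : ∀ {w} → T (q w) → w ⟶[ D ] v 1 → w ⟶[ D ] v (suc s)) where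

  open Facts c
  private
    r = 2+ s
    t = v (suc s)

    1≤r : 1 ≤ r
    1≤r = s≤s z≤n
    s≤r : suc s ≤ r
    s≤r = n≤1+n _

    on-path : Fin n → ℕ
    on-path z = ⟦ not (q z) ⟧

    module M = TournamentMatrix a (arcs-complete tournament)

    on⇒1 : ∀ {i} → i ≤ r → on-path (v i) ≡ 1
    on⇒1 {i} i≤r with T? (q (v i))
    ... | yes qv = contradiction refl (off qv i≤r)
    ... | no ¬qv with q (v i)
    ...   | false = refl
    ...   | true  = contradiction tt ¬qv

    X : Fin n → ℕ
    X z = on-path z * a z t

    X-square : ∀ z → X z * X z ≡ X z
    X-square z with q z | D z t
    ... | true  | _     = refl
    ... | false | true  = refl
    ... | false | false = refl

    L : Fin n → ℕ
    L w = o w * a (v 1) w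

    L-square : ∀ w → L w * L w ≡ L w
    L-square w with q w | D (v 1) w
    ... | true  | true  = refl
    ... | true  | false = refl
    ... | false | _     = refl

  -- In terms of thresholds, `l` counts those at most 1, `u` those at least `r`, and `n₁` those
  -- equal to 1.
  x y l u n₁ d₀ : ℕ
  x  = sum (λ z → on-path z * a (v 1) z)
  y  = sum X
  l  = sum L
  u  = sum (λ w → o w * a w t)
  n₁ = sum (λ w → o w * (a w (v 0) * a (v 1) w))
  d₀ = sum (λ z → on-path z * a z (v 0))

  private
    out-X : Fin n → ℕ
    out-X z = sum (λ z′ → X z′ * a z z′)

    -- Suppose the middle vertex `z′` is off the path. As `t` dominates `v r`, `z` is some `v i`
    -- with `i ≤ suc s`, and `in-final` makes `t` dominate `z′`. So these two-paths have their
    -- middle vertex among the in-neighbours of `t` on the path.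
    two-paths-stay : ∀ z z′ → X z ≡ 1 → a z z′ * a z′ t ≤ X z′ * a z z′
    two-paths-stay z z′ Xz with T? (q z′) | T? (D z z′) | T? (D z′ t)
    ... | yes qz′ | yes zz′ | yes z′t = contradiction (position z zz′ Xz) λ ()
      where
      position : ∀ z → z ⟶ z′ → X z ≡ 1 → 1 ≡ 0
      position z zz′ Xz with T? (q z)
      position z zz′ Xz | yes qz with q z
      position z zz′ () | yes qz | true
      position z zz′ Xz | no ¬qz with on ¬qz
      ... | i , i≤r , refl with i ≤? suc s
      ...   | yes i≤1+s = contradiction z′t (asym _ _ (in-final qz′ i≤1+s s≤r zz′))
      ...   | no i≰1+s with refl ← ≤-antisym i≤r (≰⇒> i≰1+s) =
        contradiction (trans (sym Xz) (trans (cong (on-path (v r) *_) (⟦⟧≡0 (asym _ _ (arc ≤-refl)))) (*-zeroʳ (on-path (v r))))) λ ()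
    ... | yes _ | yes _ | no ¬z′t rewrite ⟦⟧≡0 ¬z′t | *-zeroʳ (a z z′) = z≤n
    ... | yes _ | no ¬zz′ | _ rewrite ⟦⟧≡0 ¬zz′ = z≤n
    ... | no ¬qz′ | _ | _ with q z′
    ...   | true  = contradiction tt ¬qz′
    ...   | false = ≤-reflexive (trans (*-comm (a z z′) _) (cong (_* a z z′) (sym (*-identityˡ (a z′ t)))))

    X-01 : ∀ z → X z ≡ 0 ⊎ X z ≡ 1
    X-01 z with q z | D z t
    ... | true  | _     = inj₁ refl
    ... | false | true  = inj₂ refl
    ... | false | false = inj₁ refl

    X-t : X t ≡ 0
    X-t = trans (cong (on-path t *_) (⟦⟧≡0 (irrefl t))) (*-zeroʳ (on-path t))

    π≤out-X : ∀ z → X z ≡ 1 → π ≤ out-X z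
    π≤out-X z Xz = ≤-trans (two-paths z≢t) (sum-mono λ z′ → two-paths-stay z z′ Xz)
      where
      z≢t : z ≢ t
      z≢t refl with () ← trans (sym X-t) Xz

    weighted-X : M.weighted-arcs X ≡ sum (λ z → X z * out-X z)
    weighted-X = sum-cong-≗ λ z → trans
      (sum-cong-≗ λ z′ → *-assoc (X z) (X z′) (a z z′)) (sym (*-distribˡ-sum (X z) λ z′ → X z′ * a z z′))

    X-total : 2 * M.weighted-arcs X + y ≡ y * y
    X-total = trans (cong (2 * M.weighted-arcs X +_) (sym (sum-cong-≗ X-square))) (M.weighted-arcs-total X)

    πy≤arcs : y * π ≤ M.weighted-arcs X
    πy≤arcs = begin
      y * π                          ≡⟨ *-distribʳ-sum π X ⟩
      sum (λ z → X z * π)            ≤⟨ sum-mono pointwise ⟩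
      sum (λ z → X z * out-X z)      ≡⟨ weighted-X ⟨
      M.weighted-arcs X              ∎
      where
      open ≤-Reasoning
      pointwise : ∀ z → X z * π ≤ X z * out-X z
      pointwise z with X-01 z
      ... | inj₁ eq rewrite eq = z≤n
      ... | inj₂ eq = *-monoʳ-≤ (X z) (π≤out-X z eq)

    1≤y : 1 ≤ y
    1≤y = ≤-trans (≤-reflexive (sym Xs)) (term≤sum X (v s))
      where
      Xs : X (v s) ≡ 1
      Xs = cong₂ _*_ (on⇒1 (≤-trans (n≤1+n s) s≤r)) (⟦⟧≡1 (arc (n≤1+n _)))

  -- Each of the `y` in-neighbours of `t` on the path has at least `π` out-neighbours among them, so
  -- `y π ≤ y (y - 1) / 2`.
  in-degree-bound : 2 * π + 1 ≤ y
  in-degree-bound = *-cancelˡ-≤ y {{>-nonZero 1≤y}} (begin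
    y * (2 * π + 1)             ≡⟨ expand y π ⟩
    2 * (y * π) + y             ≤⟨ +-monoˡ-≤ y (*-monoʳ-≤ 2 πy≤arcs) ⟩
    2 * M.weighted-arcs X + y   ≡⟨ X-total ⟩
    y * y                       ∎)
    where
    open ≤-Reasoning
    expand : ∀ y π → y * (2 * π + 1) ≡ 2 * (y * π) + y
    expand = solve-∀

  -- If v₀ dominates the path, it takes more than its share of the arcs among the in-neighbours.
  in-degree-bound-strict : 1 ≤ π → d₀ ≡ 0 → 2 * π + 2 ≤ y
  in-degree-bound-strict 1≤π d₀≡0 with m≤n⇒m<n∨m≡n in-degree-bound
  ... | inj₁ lt = ≤-trans (≤-reflexive (+-suc (2 * π) 1)) lt
  ... | inj₂ 2π+1≡y = contradiction tight (<⇒≱ (m<m+n (y * y) (≤-trans 1≤π (m≤m+n π (π + 0)))))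
    where
    open ≤-Reasoning
    v₀-out : ∀ {i} → 1 ≤ i → i ≤ r → v 0 ⟶ v i
    v₀-out {i} 1≤i i≤r = ¬arc⇒arc (v-≢ i≤r z≤n (m<n⇒n≢0 1≤i)) λ i0 →
      contradiction (≤-trans (≤-reflexive (sym (cong₂ _*_ (on⇒1 i≤r) (⟦⟧≡1 i0))))
        (≤-trans (term≤sum (λ z → on-path z * a z (v 0)) (v i)) (≤-reflexive d₀≡0))) λ ()
    Xv₀ : X (v 0) ≡ 1
    Xv₀ = cong₂ _*_ (on⇒1 z≤n) (⟦⟧≡1 (v₀-out (s≤s z≤n) s≤r))
    pointwise-out : ∀ z → X z ≡ X z * a (v 0) z + δ (v 0) z
    pointwise-out z with X-01 z
    ... | inj₁ eq rewrite eq = sym (δ-≢ {i = v 0} {z} λ { refl → contradiction (trans (sym eq) Xv₀) λ () })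
    ... | inj₂ eq with T? (q z)
    ...   | yes qz with q z
    pointwise-out z | inj₂ () | yes _ | true
    pointwise-out z | inj₂ eq | no ¬qz with on ¬qz
    ... | zero  , _   , refl = sym (trans
          (cong₂ (λ b d → X (v 0) * b + d) (⟦⟧≡0 (irrefl (v 0))) (δ-refl (v 0)))
          (trans (cong (_+ 1) (*-zeroʳ (X (v 0)))) (sym eq)))
    ... | suc i , i≤r , refl = sym (trans (cong₂ (λ b d → X (v (suc i)) * b + d)
          (⟦⟧≡1 (v₀-out (s≤s z≤n) i≤r)) (δ-≢ (v-≢ z≤n i≤r λ ())))
          (trans (+-identityʳ _) (*-identityʳ _)))
    -- Under `y = 2 π + 1`, the vertex `v 0` is one of the in-neighbours of `t` and dominates the
    -- other `2 π`.
    out-v₀ : out-X (v 0) ≡ π + π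
    out-v₀ = +-cancelʳ-≡ 1 _ _ (trans (cong (out-X (v 0) +_) (sym (sum-δ-1 (v 0))))
      (trans (sym (∑-distrib-+ (λ z → X z * a (v 0) z) (δ (v 0))))
      (trans (sym (sum-cong-≗ pointwise-out)) (trans (sym 2π+1≡y) (cong (λ k → π + k + 1) (+-identityʳ π))))))
    pointwise : ∀ z → X z * π + δ (v 0) z * π ≤ X z * out-X z
    pointwise z with v 0 Fin.≟ z
    ... | yes refl rewrite Xv₀ = ≤-reflexive (trans (double π) (cong (_+ 0) (sym out-v₀)))
      where
      double : ∀ π → (π + 0) + (π + 0) ≡ (π + π) + 0
      double = solve-∀
    ... | no _ rewrite +-identityʳ (X z * π) with X-01 z
    ...   | inj₁ eq rewrite eq = z≤n
    ...   | inj₂ eq = *-monoʳ-≤ (X z) (π≤out-X z eq)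
    -- The surplus `π` at `v 0` pushes the count beyond `y (y - 1) / 2`, which equals `y π` here.
    arcs-bound : y * π + π ≤ M.weighted-arcs X
    arcs-bound = begin
      y * π + π                                            ≡⟨ cong₂ _+_ (*-distribʳ-sum π X) (sym (sum-δ (v 0) (λ _ → π))) ⟩
      sum (λ z → X z * π) + sum (λ z → δ (v 0) z * π)      ≡⟨ ∑-distrib-+ (λ z → X z * π) _ ⟨
      sum (λ z → X z * π + δ (v 0) z * π)                  ≤⟨ sum-mono pointwise ⟩
      sum (λ z → X z * out-X z)                            ≡⟨ weighted-X ⟨
      M.weighted-arcs X                                    ∎
    tight : y * y + 2 * π ≤ y * y
    tight = begin
      y * y + 2 * π                ≡⟨ cong (λ k → y * k + 2 * π) 2π+1≡y ⟨
      y * (2 * π + 1) + 2 * π      ≡⟨ expand y π ⟩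
      2 * (y * π + π) + y          ≤⟨ +-monoˡ-≤ y (*-monoʳ-≤ 2 arcs-bound) ⟩
      2 * M.weighted-arcs X + y    ≡⟨ X-total ⟩
      y * y                        ∎
      where
      expand : ∀ y π → y * (2 * π + 1) + 2 * π ≡ 2 * (y * π + π) + y
      expand = solve-∀

  x+l≡m : x + l ≡ m
  x+l≡m = trans (sym (sum-split-on (a (v 1)))) (outs (v 1))

  y+u≡m : y + u ≡ m
  y+u≡m = trans (sym (sum-split-on λ z → a z t)) (ins t)

  private
    L⊎U : ∀ w → o w ≡ L w + o w * a w t
    L⊎U w with T? (q w)
    ... | no ¬qw rewrite ⟦⟧≡0 ¬qw = refl
    ... | yes qw with T? (D (v 1) w)
    ...   | yes 1w rewrite ⟦⟧≡1 qw | ⟦⟧≡1 1w | ⟦⟧≡0 (asym _ _ (in-final qw (s≤s z≤n) s≤r 1w)) = refl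
    ...   | no ¬1w rewrite ⟦⟧≡1 qw | ⟦⟧≡0 ¬1w | ⟦⟧≡1 (narrow qw (leaves qw 1≤r ¬1w)) = refl

  -- By `narrow` every vertex off the path is counted once in `l + u`, so `n = r + 1 + l + u`, while
  -- the full degrees `x + l` and `y + u` add up to `n - 1`.
  x+y≡r : x + y ≡ r
  x+y≡r = +-cancelʳ-≡ (suc (l + u)) _ _ (begin
    x + y + suc (l + u)            ≡⟨ regroup x y l u ⟩
    suc ((x + l) + (y + u))        ≡⟨ cong₂ (λ j k → suc (j + k)) x+l≡m y+u≡m ⟩
    suc (m + m)                    ≡⟨ cong (λ k → suc (m + k)) (+-identityʳ m) ⟨
    suc (2 * m)                    ≡⟨ order ⟨
    n                              ≡⟨ trans (sym (sum-const-1 n)) (sum-split (λ _ → 1)) ⟩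
    ∑< (suc r) (λ _ → 1) + sum (λ w → o w * 1)
      ≡⟨ cong₂ _+_ (sum-const-1 (suc r)) (sum-cong-≗ λ w → trans (*-identityʳ (o w)) (L⊎U w)) ⟩
    suc r + sum (λ w → L w + o w * a w t)  ≡⟨ cong (suc r +_) (∑-distrib-+ L _) ⟩
    suc r + (l + u)                ≡⟨ +-suc r (l + u) ⟨
    r + suc (l + u)                ∎)
    where
    open ≡-Reasoning
    regroup : ∀ x y l u → x + y + suc (l + u) ≡ suc ((x + l) + (y + u))
    regroup = solve-∀

  -- If `l` does not count `w`, then `w` dominates `v 0`, ..., `v (r - 1)`, so `r ≤ m`. With
  -- `r = x + y` and `m = x + l` this gives `y ≤ l`.
  l-positive : ∀ {w} → T (q w) → 1 ≤ l
  l-positive {w} qw with T? (D (v 1) w)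
  ... | yes 1w = ≤-trans (≤-reflexive (sym (cong₂ _*_ (⟦⟧≡1 qw) (⟦⟧≡1 1w)))) (term≤sum L w)
  ... | no ¬1w = ≤-trans 1≤y (+-cancelˡ-≤ x y l (begin
    x + y                             ≡⟨ x+y≡r ⟩
    r                                 ≡⟨ ∑<-below (n≤1+n r) ⟨
    ∑< (suc r) (below r)              ≤⟨ ∑<-mono pointwise ⟩
    ∑< (suc r) (λ i → a w (v i))      ≤⟨ m≤m+n _ _ ⟩
    ∑< (suc r) (λ i → a w (v i)) + _  ≡⟨ sum-split (a w) ⟨
    sum (a w)                         ≡⟨ trans (outs w) (sym x+l≡m) ⟩
    x + l                             ∎))
    where
    open ≤-Reasoning
    pointwise : ∀ {i} → i < suc r → below r i ≤ a w (v i)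
    pointwise {i} _ with i <? r
    ... | yes i<r = ≤-reflexive (trans (below-< i<r) (sym (⟦⟧≡1
          (out-initial qw (≤-pred i<r) s≤r (narrow qw (leaves qw 1≤r ¬1w))))))
    ... | no i≮r  = ≤-trans (≤-reflexive (below-≥ (≮⇒≥ i≮r))) z≤n

  private
    n₁≤l : n₁ ≤ l
    n₁≤l = sum-mono λ w → *-monoʳ-≤ (o w) (≤-trans (*-monoˡ-≤ (a (v 1) w) (⟦⟧≤1 (D w (v 0))))
      (≤-reflexive (*-identityˡ _)))

    -- The in-degree of `v 0`: off the path, it is dominated by the vertices with threshold 1 or at
    -- least `r`.
    d₀+n₁≡y : d₀ + n₁ ≡ y
    d₀+n₁≡y = +-cancelʳ-≡ u _ _ (begin
      d₀ + n₁ + u                                        ≡⟨ +-assoc d₀ n₁ u ⟩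
      d₀ + (n₁ + u)                                      ≡⟨ cong (d₀ +_) (∑-distrib-+ (λ w → o w * (a w (v 0) * a (v 1) w)) _) ⟨
      d₀ + sum (λ w → o w * (a w (v 0) * a (v 1) w) + o w * a w t)
                                                         ≡⟨ cong (d₀ +_) (sum-cong-≗ pointwise) ⟨
      d₀ + sum (λ w → o w * a w (v 0))                   ≡⟨ sum-split-on (λ z → a z (v 0)) ⟨
      sum (λ z → a z (v 0))                              ≡⟨ trans (ins (v 0)) (sym y+u≡m) ⟩
      y + u                                              ∎)
      where
      open ≡-Reasoning
      pointwise : ∀ w → o w * a w (v 0) ≡ o w * (a w (v 0) * a (v 1) w) + o w * a w t
      pointwise w with T? (q w)
      ... | no ¬qw rewrite ⟦⟧≡0 ¬qw = refl
      ... | yes qw with T? (D (v 1) w)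
      ...   | yes 1w rewrite ⟦⟧≡1 qw | ⟦⟧≡1 1w | ⟦⟧≡0 (asym _ _ (in-final qw (s≤s z≤n) s≤r 1w))
                           | *-identityʳ (a w (v 0)) = sym (+-identityʳ (a w (v 0) + 0))
      ...   | no ¬1w rewrite ⟦⟧≡1 qw | ⟦⟧≡0 ¬1w | ⟦⟧≡1 (narrow qw (leaves qw 1≤r ¬1w))
                           | ⟦⟧≡1 (out-initial qw z≤n 1≤r (leaves qw 1≤r ¬1w)) = refl

    -- Sums the out-degrees of the `l` vertices. Their only possible out-neighbour on the path is
    -- `v 0`, which accounts for `n₁`; other arcs stay among them or end in one of the `u` vertices.
    L-out : l * m ≤ n₁ + (M.weighted-arcs L + l * u)
    L-out = begin
      l * m
        ≡⟨ *-distribʳ-sum m L ⟩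
      sum (λ w → L w * m)
        ≡⟨ sum-cong-≗ (λ w → cong (L w *_) (trans (sym (outs w)) (sum-split (a w)))) ⟩
      sum (λ w → L w * (∑< (suc r) (λ i → a w (v i)) + sum (λ z → o z * a w z)))
        ≤⟨ sum-mono pointwise ⟩
      sum (λ w → o w * (a w (v 0) * a (v 1) w) + (sum (λ z → L w * L z * a w z) + L w * u))
        ≡⟨ trans (∑-distrib-+ (λ w → o w * (a w (v 0) * a (v 1) w)) _)
             (cong (n₁ +_) (trans (∑-distrib-+ (λ w → sum (λ z → L w * L z * a w z)) _)
               (cong (M.weighted-arcs L +_) (sym (*-distribʳ-sum u L))))) ⟩
      n₁ + (M.weighted-arcs L + l * u) ∎
      where
      open ≤-Reasoning
      path-part : ∀ w → L w * ∑< (suc r) (λ i → a w (v i)) ≡ o w * (a w (v 0) * a (v 1) w)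
      path-part w with T? (q w)
      ... | no ¬qw rewrite ⟦⟧≡0 ¬qw = refl
      ... | yes qw with T? (D (v 1) w)
      ...   | no ¬1w rewrite ⟦⟧≡1 qw | ⟦⟧≡0 ¬1w | *-zeroʳ (a w (v 0)) = refl
      ...   | yes 1w rewrite ⟦⟧≡1 qw | ⟦⟧≡1 1w = cong (_+ 0) (trans
        (cong (a w (v 0) +_) (sum-zero λ i → ⟦⟧≡0 (asym _ _ (in-final qw (s≤s z≤n) (Fin.toℕ<n i) 1w))))
        (trans (+-identityʳ _) (sym (*-identityʳ _))))
      rest-part : ∀ w → L w * sum (λ z → o z * a w z) ≤ sum (λ z → L w * L z * a w z) + L w * u
      rest-part w = begin
        L w * sum (λ z → o z * a w z)
          ≤⟨ *-monoʳ-≤ (L w) (sum-mono bound) ⟩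
        L w * sum (λ z → L z * a w z + o z * a z t)
          ≡⟨ cong (L w *_) (∑-distrib-+ (λ z → L z * a w z) _) ⟩
        L w * (sum (λ z → L z * a w z) + u)
          ≡⟨ trans (*-distribˡ-+ (L w) _ u) (cong (_+ L w * u) (trans (*-distribˡ-sum (L w) (λ z → L z * a w z))
               (sum-cong-≗ λ z → sym (*-assoc (L w) (L z) (a w z))))) ⟩
        sum (λ z → L w * L z * a w z) + L w * u ∎
        where
        bound : ∀ z → o z * a w z ≤ L z * a w z + o z * a z t
        bound z = ≤-trans (≤-reflexive (trans (cong (_* a w z) (L⊎U z)) (*-distribʳ-+ (a w z) (L z) _)))
          (+-monoʳ-≤ (L z * a w z) (≤-trans (*-monoʳ-≤ (o z * a z t) (⟦⟧≤1 (D w z))) (≤-reflexive (*-identityʳ _))))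
      pointwise : ∀ w → L w * (∑< (suc r) (λ i → a w (v i)) + sum (λ z → o z * a w z))
        ≤ o w * (a w (v 0) * a (v 1) w) + (sum (λ z → L w * L z * a w z) + L w * u)
      pointwise w = ≤-trans (≤-reflexive (*-distribˡ-+ (L w) _ _))
        (+-mono-≤ (≤-reflexive (path-part w)) (rest-part w))

    -- `L-out` doubled, with `m = y + u` and `l (l - 1) / 2` arcs inside the set; the products
    -- `l * u` cancel.
    L-quadratic : l * (2 * y + 1) ≤ 2 * n₁ + l * l
    L-quadratic = +-cancelʳ-≤ (2 * (l * u)) _ _ (begin
      l * (2 * y + 1) + 2 * (l * u)
        ≡⟨ regroup l y u ⟩
      2 * (l * (y + u)) + l
        ≡⟨ cong (λ k → 2 * (l * k) + l) y+u≡m ⟩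
      2 * (l * m) + l
        ≤⟨ +-monoˡ-≤ l (*-monoʳ-≤ 2 L-out) ⟩
      2 * (n₁ + (M.weighted-arcs L + l * u)) + l
        ≡⟨ regroup′ n₁ (M.weighted-arcs L) (l * u) l ⟩
      2 * n₁ + (2 * M.weighted-arcs L + l) + 2 * (l * u)
        ≡⟨ cong (λ k → 2 * n₁ + k + 2 * (l * u)) (trans (cong (2 * M.weighted-arcs L +_)
             (sym (sum-cong-≗ L-square))) (M.weighted-arcs-total L)) ⟩
      2 * n₁ + l * l + 2 * (l * u) ∎)
      where
      open ≤-Reasoning
      regroup : ∀ l y u → l * (2 * y + 1) + 2 * (l * u) ≡ 2 * (l * (y + u)) + l
      regroup = solve-∀
      regroup′ : ∀ a b c d → 2 * (a + (b + c)) + d ≡ 2 * a + (2 * b + d) + 2 * c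
      regroup′ = solve-∀

  -- In the extremal case `l = 2 y`, `L-quadratic` forces `d₀ = 0`, and the stricter bound on `y`
  -- makes up for the missing unit.
  l-bound : ∀ {w} → T (q w) → 1 ≤ π → 2 * y + 1 ≤ l ⊎ (2 * y ≤ l × 2 * π + 2 ≤ y)
  l-bound qw 1≤π with <-cmp l (2 * y)
  ... | tri> _ _ 2y<l = inj₁ (≤-trans (≤-reflexive (+-comm (2 * y) 1)) 2y<l)
  ... | tri≈ _ l≡2y _ = inj₂ (≤-reflexive (sym l≡2y) , in-degree-bound-strict 1≤π d₀≡0)
    where
    open ≤-Reasoning
    y≤n₁ : y ≤ n₁
    y≤n₁ = *-cancelˡ-≤ 2 (+-cancelʳ-≤ (l * l) _ _ (begin
      2 * y + l * l     ≡⟨ cong (_+ l * l) l≡2y ⟨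
      l + l * l         ≡⟨ expand l ⟩
      l * (l + 1)       ≡⟨ cong (λ k → l * (k + 1)) l≡2y ⟩
      l * (2 * y + 1)   ≤⟨ L-quadratic ⟩
      2 * n₁ + l * l    ∎))
      where
      expand : ∀ l → l + l * l ≡ l * (l + 1)
      expand = solve-∀
    d₀≡0 : d₀ ≡ 0
    d₀≡0 = n≤0⇒n≡0 (+-cancelʳ-≤ n₁ d₀ 0 (≤-trans (≤-reflexive d₀+n₁≡y) y≤n₁))
  -- First `n₁ ≤ l` leaves only `2 y = l + 1`; then the sharper `n₁ ≤ y` gives `l ≤ 1`, against
  -- `l ≥ 5` from `y ≥ 3`.
  ... | tri< l<2y _ _ = contradiction small (<⇒≱ (≤-trans (s≤s (s≤s z≤n)) l≥5))
    where
    open ≤-Reasoning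
    2y≤1+l : 2 * y + 1 ≤ 2 + l
    2y≤1+l = *-cancelˡ-≤ l {{>-nonZero (l-positive qw)}} (begin
      l * (2 * y + 1)   ≤⟨ L-quadratic ⟩
      2 * n₁ + l * l    ≤⟨ +-monoˡ-≤ (l * l) (*-monoʳ-≤ 2 n₁≤l) ⟩
      2 * l + l * l     ≡⟨ *-distribʳ-+ l 2 l ⟨
      (2 + l) * l       ≡⟨ *-comm (2 + l) l ⟩
      l * (2 + l)       ∎)
    2y≡1+l : 2 * y ≡ suc l
    2y≡1+l = ≤-antisym (≤-pred (≤-trans (≤-reflexive (+-comm 1 (2 * y))) 2y≤1+l)) l<2y
    n₁≤y : n₁ ≤ y
    n₁≤y = ≤-trans (m≤n+m n₁ d₀) (≤-reflexive d₀+n₁≡y)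
    small : l ≤ 1
    small = +-cancelˡ-≤ l l 1 (+-cancelʳ-≤ (l * l) _ _ (begin
      l + l + l * l                  ≡⟨ expand l ⟩
      l * (suc l + 1)                ≡⟨ cong (λ k → l * (k + 1)) 2y≡1+l ⟨
      l * (2 * y + 1)                ≤⟨ L-quadratic ⟩
      2 * n₁ + l * l                 ≤⟨ +-monoˡ-≤ (l * l) (*-monoʳ-≤ 2 n₁≤y) ⟩
      2 * y + l * l                  ≡⟨ cong (_+ l * l) (trans 2y≡1+l (+-comm 1 l)) ⟩
      l + 1 + l * l                  ∎))
      where
      expand : ∀ l → l + l + l * l ≡ l * (suc l + 1)
      expand = solve-∀
    l≥5 : 5 ≤ l
    l≥5 = ≤-pred (begin
      6             ≤⟨ *-monoʳ-≤ 2 (+-monoˡ-≤ 1 (*-monoʳ-≤ 2 1≤π)) ⟩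
      2 * (2 * π + 1) ≤⟨ *-monoʳ-≤ 2 in-degree-bound ⟩
      2 * y         ≡⟨ 2y≡1+l ⟩
      suc l         ∎)

-- Reversal exchanges `x` with `y` and `l` with `u`, so the bounds hold on both sides. Then `2 m` is
-- at least `3 x + 3 y + 1`, or at least `3 x + 3 y` with `y ≥ 2 π + 2`; either way it exceeds
-- `12 π + 6`.
shallow-impossible : ∀ {D : Digraph n} {v q m s π} → Config D v q m (2+ s) π →
  1 ≤ π → n < 12 * π + 9 → ∀ {w₀} → T (q w₀) →
  (∀ {w} → T (q w) → w ⟶[ D ] v 1 → ¬ v (suc s) ⟶[ D ] w) → ⊥
shallow-impossible {n = n} {D} {v} {q} {m} {s} {π} c 1≤π n<12π+9 qw₀ shallow = clash (S.l-bound qw₀ 1≤π)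
  where
  open Facts c
  -- The index `r ∸ suc s` of the reversed path computes to `suc s ∸ s`.
  v₁≡ : v 1 ≡ v (suc s ∸ s)
  v₁≡ = cong v (sym (m+n∸n≡m 1 s))
  narrow : ∀ {w} → T (q w) → w ⟶ v 1 → w ⟶ v (suc s)
  narrow qw w1 = leaves qw (n≤1+n _) (shallow qw w1)
  narrow-reverse : ∀ {w} → T (q w) → v (suc s) ⟶ w → v (suc s ∸ s) ⟶ w
  narrow-reverse {w} qw sw = subst (_⟶ w) v₁≡ (enters qw (s≤s z≤n) λ w1 → shallow qw w1 sw)
  module S = Shallow c narrow
  module R = Shallow (reverse c) narrow-reverse
  x≡ : R.y ≡ S.x
  x≡ = sum-cong-≗ λ z → cong (λ x → ⟦ not (q z) ⟧ * ⟦ D x z ⟧) (sym v₁≡)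
  open ≤-Reasoning
  x y l u : ℕ
  x = S.x
  y = S.y
  l = S.l
  u = S.u
  x-bound : 2 * π + 1 ≤ x
  x-bound = ≤-trans R.in-degree-bound (≤-reflexive x≡)
  u-bound : 2 * x ≤ u
  u-bound with R.l-bound qw₀ 1≤π
  ... | inj₁ b       = ≤-trans (m≤m+n (2 * x) 1) (≤-trans (≤-reflexive (cong (λ k → 2 * k + 1) (sym x≡))) b)
  ... | inj₂ (b , _) = ≤-trans (≤-reflexive (cong (2 *_) (sym x≡))) b
  upper : (x + l) + (y + u) ≤ 12 * π + 6
  upper = begin
    (x + l) + (y + u)   ≡⟨ cong₂ _+_ S.x+l≡m S.y+u≡m ⟩
    m + m               ≡⟨ cong (m +_) (+-identityʳ m) ⟨
    -- Parity gains a unit: `n = 2 m + 1 < 12 π + 9` gives `m ≤ 6 π + 3`.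
    2 * m               ≤⟨ *-monoʳ-≤ 2 {m} {6 * π + 3} (halve (≤-pred (≤-pred (begin
      2+ (2 * m)              ≡⟨ cong suc order ⟨
      suc n                   ≤⟨ n<12π+9 ⟩
      12 * π + 9              ≡⟨ expand π ⟩
      3 + 2 * (6 * π + 3)     ∎)))) ⟩
    2 * (6 * π + 3)     ≡⟨ expand′ π ⟩
    12 * π + 6          ∎
    where
    expand : ∀ π → 12 * π + 9 ≡ 3 + 2 * (6 * π + 3)
    expand = solve-∀
    expand′ : ∀ π → 2 * (6 * π + 3) ≡ 12 * π + 6
    expand′ = solve-∀
    halve : ∀ {j k} → 2 * j ≤ suc (2 * k) → j ≤ k
    halve {j} {k} 2j≤ = ≮⇒≥ λ k<j → contradiction (≤-trans (*-monoʳ-≤ 2 k<j) 2j≤)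
      (<⇒≱ (≤-reflexive (sym (*-suc 2 k))))
  clash : 2 * y + 1 ≤ l ⊎ (2 * y ≤ l × 2 * π + 2 ≤ y) → ⊥
  clash (inj₁ l-large) = <⇒≱ (begin-strict
    12 * π + 6                                          <⟨ ≤-reflexive (expand π) ⟩
    3 * (2 * π + 1) + (3 * (2 * π + 1) + 1)
      ≤⟨ +-mono-≤ (*-monoʳ-≤ 3 x-bound) (+-monoˡ-≤ 1 (*-monoʳ-≤ 3 S.in-degree-bound)) ⟩
    3 * x + (3 * y + 1)                                 ≡⟨ regroup x y ⟩
    (x + (2 * y + 1)) + (y + 2 * x)                     ≤⟨ +-mono-≤ (+-monoʳ-≤ x l-large) (+-monoʳ-≤ y u-bound) ⟩
    (x + l) + (y + u)                                   ∎) upper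
    where
    expand : ∀ π → suc (12 * π + 6) ≡ 3 * (2 * π + 1) + (3 * (2 * π + 1) + 1)
    expand = solve-∀
    regroup : ∀ x y → 3 * x + (3 * y + 1) ≡ (x + (2 * y + 1)) + (y + 2 * x)
    regroup = solve-∀
  clash (inj₂ (l-large , y-large)) = <⇒≱ (begin-strict
    12 * π + 6                                          <⟨ m<m+n (12 * π + 6) (s≤s z≤n) ⟩
    12 * π + 6 + 3                                      ≡⟨ expand π ⟩
    3 * (2 * π + 1) + 3 * (2 * π + 2)                   ≤⟨ +-mono-≤ (*-monoʳ-≤ 3 x-bound) (*-monoʳ-≤ 3 y-large) ⟩
    3 * x + 3 * y                                       ≡⟨ regroup x y ⟩
    (x + 2 * y) + (y + 2 * x)                           ≤⟨ +-mono-≤ (+-monoʳ-≤ x l-large) (+-monoʳ-≤ y u-bound) ⟩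
    (x + l) + (y + u)                                   ∎) upper
    where
    expand : ∀ π → 12 * π + 6 + 3 ≡ 3 * (2 * π + 1) + 3 * (2 * π + 2)
    expand = solve-∀
    regroup : ∀ x y → 3 * x + 3 * y ≡ (x + 2 * y) + (y + 2 * x)
    regroup = solve-∀

-- A vertex off the path with threshold between 2 and r - 1

δ≤ : ∀ {f : Fin k → ℕ} {j} → 1 ≤ f j → ∀ i → δ j i ≤ f i
δ≤ {j = j} 1≤fj i with j Fin.≟ i
... | yes refl = 1≤fj
... | no _     = z≤n

remove-unit : ∀ {f : Fin k → ℕ} {j} → 1 ≤ f j → sum f ≡ suc (sum (λ i → f i ∸ δ j i))
remove-unit {f = f} {j} 1≤fj = trans (sum-cong-≗ λ i → sym (m+[n∸m]≡n (δ≤ {f = f} {j} 1≤fj i)))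
  (trans (∑-distrib-+ (δ j) _) (cong (_+ sum (λ i → f i ∸ δ j i)) (sum-δ-1 j)))

remove-unit-* : ∀ {f : Fin k → ℕ} {j} → 1 ≤ f j → ∀ (g : Fin k → ℕ) →
  sum (λ i → f i * g i) ≡ g j + sum (λ i → (f i ∸ δ j i) * g i)
remove-unit-* {f = f} {j} 1≤fj g = trans
  (sum-cong-≗ λ i → trans (cong (_* g i) (sym (m+[n∸m]≡n (δ≤ {f = f} {j} 1≤fj i)))) (*-distribʳ-+ (g i) (δ j i) _))
  (trans (∑-distrib-+ (λ i → δ j i * g i) _) (cong (_+ sum (λ i → (f i ∸ δ j i) * g i)) (sum-δ j g)))

weighted-sum-0 : ∀ {f : Fin k → ℕ} → sum f ≡ 0 → ∀ (g : Fin k → ℕ) → sum (λ i → f i * g i) ≡ 0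
weighted-sum-0 {f = f} eq g = sum-zero {f = λ i → f i * g i} λ i →
  cong (_* g i) (n≤0⇒n≡0 (≤-trans (term≤sum f i) (≤-reflexive eq)))

weighted-sum-1 : ∀ {f : Fin k → ℕ} {j} → 1 ≤ f j → sum f ≡ 1 → ∀ (g : Fin k → ℕ) → sum (λ i → f i * g i) ≡ g j
weighted-sum-1 {f = f} {j} 1≤fj eq g = trans (remove-unit-* {f = f} {j} 1≤fj g) (trans
  (cong (g j +_) (weighted-sum-0 {f = λ i → f i ∸ δ j i} (suc-injective (trans (sym (remove-unit {f = f} {j} 1≤fj)) eq)) g))
  (+-identityʳ (g j)))

-- Removing one unit at `j` leaves total weight 1, concentrated at some `j′`, so `f` acts as a sum
-- of two unit vectors.
weighted-sum-2 : ∀ {f : Fin k → ℕ} {j} → 1 ≤ f j → sum f ≡ 2 →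
  ∃ λ j′ → 1 ≤ f j′ × (∀ (g : Fin k → ℕ) → sum (λ i → f i * g i) ≡ g j + g j′)
weighted-sum-2 {f = f} {j} 1≤fj eq with sum-positive f′ (≤-reflexive (sym sum-f′))
  where
  f′ = λ i → f i ∸ δ j i
  sum-f′ : sum f′ ≡ 1
  sum-f′ = suc-injective (trans (sym (remove-unit {f = f} {j} 1≤fj)) eq)
... | j′ , 1≤f′j′ = j′ , ≤-trans 1≤f′j′ (m∸n≤m (f j′) (δ j j′)) , λ g →
  trans (remove-unit-* {f = f} {j} 1≤fj g) (cong (g j +_) (weighted-sum-1 {f = λ i → f i ∸ δ j i} {j′} 1≤f′j′
    (suc-injective (trans (sym (remove-unit {f = f} {j} 1≤fj)) eq)) g))

module Thresholds {D : Digraph n} {v q m r π} (c : Config D v q m r π) where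
  open Facts c

  IsThreshold : Fin n → ℕ → Set
  IsThreshold w t = t ≤ suc r × (∀ {i} → i < t → w ⟶ v i) × (∀ {i} → t ≤ i → i ≤ r → v i ⟶ w)

  threshold : ∀ {w} → T (q w) → ∃ (IsThreshold w)
  threshold {w} qw = go (suc r) ≤-refl λ r<i i≤r → contradiction i≤r (<⇒≱ r<i)
    where
    go : ∀ k → k ≤ suc r → (∀ {i} → k ≤ i → i ≤ r → v i ⟶ w) → ∃ (IsThreshold w)
    go zero    _   above = 0 , z≤n , (λ ()) , above
    go (suc k) k<p above with T? (D w (v k))
    ... | yes wk = suc k , k<p , (λ i<1+k → out-initial qw (≤-pred i<1+k) (≤-pred k<p) wk) , above
    ... | no ¬wk = go k (<⇒≤ k<p) λ k≤i i≤r → in-final qw k≤i i≤r (enters qw (≤-pred k<p) ¬wk)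

  threshold-count : ∀ {w t} → IsThreshold w t → ∑< (suc r) (λ b → a (v b) w) + t ≡ suc r
  threshold-count {w} {t} (t≤p , low , high) = begin
    ∑< (suc r) (λ b → a (v b) w) + t                       ≡⟨ cong (∑< (suc r) (λ b → a (v b) w) +_) (∑<-below t≤p) ⟨
    ∑< (suc r) (λ b → a (v b) w) + ∑< (suc r) (below t)    ≡⟨ ∑-distrib-+ {suc r} (λ b → a (v (toℕ b)) w) (below t ∘ toℕ) ⟨
    ∑< (suc r) (λ b → a (v b) w + below t b)               ≡⟨ ∑<-cong pointwise ⟩
    ∑< (suc r) (λ _ → 1)                                   ≡⟨ sum-const-1 (suc r) ⟩
    suc r                                                  ∎
    where
    open ≡-Reasoning
    pointwise : ∀ {b} → b < suc r → a (v b) w + below t b ≡ 1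
    pointwise {b} b<p with b <? t
    ... | yes b<t = cong₂ _+_ (⟦⟧≡0 (asym _ _ (low b<t))) (below-< b<t)
    ... | no b≮t  = cong₂ _+_ (⟦⟧≡1 (high (≮⇒≥ b≮t) (≤-pred b<p))) (below-≥ (≮⇒≥ b≮t))

  mixed-intro : ∀ {w} → T (q w) → w ⟶ v 0 → v r ⟶ w → mixed w ≡ 1
  mixed-intro qw w0 rw rewrite ⟦⟧≡1 qw | ⟦⟧≡1 w0 | ⟦⟧≡1 rw = refl

  mixed-elim : ∀ {w} → 1 ≤ mixed w → T (q w) × w ⟶ v 0 × v r ⟶ w
  mixed-elim {w} 1≤ with q w | D w (v 0) | D (v r) w
  ... | true | true | true = tt , tt , tt

  two-path : 1 ≤ π → ∀ {x y} → x ≢ y → ∃ λ z → x ⟶ z × z ⟶ y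
  two-path 1≤π {x} {y} x≢y with sum-positive (λ z → a x z * a z y) (≤-trans 1≤π (two-paths x≢y))
  ... | z , 1≤ with D x z in xz | D z y in zy
  ...   | true | true = z , subst T (sym xz) tt , subst T (sym zy) tt

  -- A middle vertex off the path is impossible: if `v i` dominates it, so does the later `v j`, by
  -- `in-final`.
  two-path-on-path : 1 ≤ π → ∀ {i j} → i < j → j ≤ r → ∃ λ l → l ≤ r × v i ⟶ v l × v l ⟶ v j
  two-path-on-path 1≤π {i} {j} i<j j≤r with two-path 1≤π (v-≢ (≤-trans (<⇒≤ i<j) j≤r) j≤r (<⇒≢ i<j))
  ... | z , iz , zj with T? (q z)
  ...   | yes qz = contradiction (in-final qz (<⇒≤ i<j) j≤r iz) (asym _ _ zj)
  ...   | no ¬qz with on ¬qz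
  ...     | l , l≤r , refl = l , l≤r , iz , zj

-- The degrees leave v (2+ s) no out-neighbours on the path but v (3 + s) and predecessors of out-neighbours
-- of v 0; by no-swap the latter do not dominate v (3 + s), so no two-path joins v (2+ s) to v (3 + s).
penultimate-impossible : ∀ {D : Digraph n} {v q m s π} (c : Config D v q m (3 + s) π) → 1 ≤ π →
  ∀ {w₀} → T (q w₀) → w₀ ⟶[ D ] v 1 → v (suc s) ⟶[ D ] w₀ →
  ¬ sum (λ w → Facts.mixed c w * ⟦ D (v (2+ s)) w ⟧) ≡ 2
penultimate-impossible {D = D} {v} {q} {m} {s} {π} c 1≤π {w₀} qw₀ w₀1 sw₀ mixed≡2 =
  case-middle (two-path-on-path 1≤π ≤-refl ≤-refl)
  where
  open Facts c
  open Thresholds c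
  r = 3 + s
  F G : ℕ → ℕ
  F i = a (v 0) (v (2+ i))
  G i = a (v (2+ s)) (v (suc i))
  a₀ x ε : ℕ
  a₀ = a (v (2+ s)) (v 0)
  x  = F s
  ε  = F (suc s)
  2+s≤r : 2+ s ≤ r
  2+s≤r = n≤1+n _
  1+s≤r : 1 + s ≤ r
  1+s≤r = ≤-trans (n≤1+n _) 2+s≤r
  d₁≡ : out-on-path 0 ≡ 1 + (∑< s F + x + ε)
  d₁≡ = cong₂ _+_ (⟦⟧≡0 (irrefl (v 0))) (cong₂ _+_ (⟦⟧≡1 (arc (s≤s z≤n)))
    (trans (∑<-last (suc s) F) (cong (_+ ε) (∑<-last s F))))
  out≡ : out-on-path (2+ s) ≡ a₀ + (∑< s G + 0 + 0 + 1)
  out≡ = cong (a₀ +_) (trans (∑<-last (2+ s) G) (cong₂ _+_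
    (trans (∑<-last (suc s) G) (cong₂ _+_
      (trans (∑<-last s G) (cong (∑< s G +_) (⟦⟧≡0 (asym _ _ (arc {suc s} 2+s≤r)))))
      (⟦⟧≡0 (irrefl (v (2+ s))))))
    (⟦⟧≡1 (arc ≤-refl))))
  -- Compared with `v 0`, the two mixed out-neighbours cost `v (2+ s)` two places on the path; the
  -- end terms `x` and `ε` are estimated by 1.
  few : a₀ + ∑< s G ≤ ∑< s F
  few = +-cancelʳ-≤ 3 _ _ (begin
    a₀ + ∑< s G + 3                    ≡⟨ regroup a₀ (∑< s G) ⟩
    a₀ + (∑< s G + 0 + 0 + 1) + 2              ≡⟨ cong₂ _+_ out≡ mixed≡2 ⟨
    out-on-path (2+ s) + sum (λ w → mixed w * a (v (2+ s)) w)
                                       ≡⟨ mixed-out-degree 2+s≤r ⟩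
    out-on-path 0                      ≡⟨ d₁≡ ⟩
    1 + (∑< s F + x + ε)               ≤⟨ s≤s (+-mono-≤ (+-monoʳ-≤ (∑< s F) (⟦⟧≤1 (D (v 0) (v (2+ s))))) (⟦⟧≤1 (D (v 0) (v r)))) ⟩
    1 + (∑< s F + 1 + 1)               ≡⟨ regroup′ (∑< s F) ⟩
    ∑< s F + 3                         ∎)
    where
    open ≤-Reasoning
    regroup : ∀ a g → a + g + 3 ≡ a + (g + 0 + 0 + 1) + 2
    regroup = solve-∀
    regroup′ : ∀ f → 1 + (f + 1 + 1) ≡ f + 3
    regroup′ = solve-∀
  -- The opposite inequality, term by term: if `v 0` dominates `v (2+ i)`, `no-swap` keeps
  -- `v (suc i)` from dominating `v (2+ s)`. With `few` there is equality throughout and `a₀ = 0`.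
  F≤G : ∀ {i} → i < s → F i ≤ G i
  F≤G {i} i<s with T? (D (v 0) (v (2+ i)))
  ... | no ¬0i = ≤-trans (≤-reflexive (⟦⟧≡0 ¬0i)) z≤n
  ... | yes 0i = ≤-trans (⟦⟧≤1 (D (v 0) (v (2+ i)))) (≤-reflexive (sym (⟦⟧≡1 (¬arc⇒arc
        (v-≢ (≤-trans (s≤s (<⇒≤ i<s)) 1+s≤r) 2+s≤r (<⇒≢ (s≤s (m≤n⇒m≤1+n i<s))))
        λ is → no-swap (s≤s z≤n) (s≤s i<s) 2+s≤r qw₀ 0i is sw₀ w₀1))))
  case-middle : (∃ λ l → l ≤ r × v (2+ s) ⟶ v l × v l ⟶ v r) → ⊥
  case-middle (zero , _ , s0 , _) =
    <⇒≱ (≤-trans (s≤s (∑<-mono F≤G)) (≤-reflexive (cong (_+ ∑< s G) (sym (⟦⟧≡1 s0))))) few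
  case-middle (suc l , l<r , sl , lr) with <-cmp l s
  -- This middle vertex gives `G l = 1`, and `F l = 0` by a second use of `no-swap`, so equality
  -- fails at `l`.
  ... | tri< l<s _ _ = <⇒≱ (≤-trans (∑<-mono-< F≤G l<s (≤-trans
          (s≤s (≤-reflexive (⟦⟧≡0 λ 0l → no-swap (s≤s z≤n) (s≤s (m≤n⇒m≤1+n l<s)) ≤-refl qw₀ 0l lr
            (in-final qw₀ (n≤1+n _) 2+s≤r sw₀) w₀1)))
          (≤-reflexive (sym (⟦⟧≡1 sl))))) (m≤n+m _ a₀)) few
  ... | tri≈ _ refl _ = asym _ _ sl (arc 2+s≤r)
  ... | tri> _ _ s<l with m≤n⇒m<n∨m≡n s<l
  ...   | inj₂ refl = irrefl _ sl
  ...   | inj₁ 1+s<l with refl ← ≤-antisym (≤-pred l<r) 1+s<l = irrefl _ lr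

-- A single mixed vertex, with threshold `u + 2` on a path of `2 u + 4` vertices

module SingleMixed {D : Digraph n} {v q m π} (u : ℕ) (c : Config D v q m (3 + (u + u)) π)
  {w₀} (qw₀ : T (q w₀))
  (low  : ∀ {i} → i ≤ suc u → w₀ ⟶[ D ] v i)
  (high : ∀ {i} → 2+ u ≤ i → i ≤ 3 + (u + u) → v i ⟶[ D ] w₀)
  (out-low  : ∀ {b} → b ≤ suc u → Facts.out-on-path c b ≡ 2+ u)
  (out-high : ∀ {b} → 2+ u ≤ b → b ≤ 3 + (u + u) → Facts.out-on-path c b ≡ suc u)
  (middle≤1 : ∀ {i} → i < suc (u + u) → ⟦ D (v 0) (v (2+ i)) ⟧ + ⟦ D (v (suc i)) (v (3 + (u + u))) ⟧ ≤ 1)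
  (middle   : ∑< (suc (u + u)) (λ i → ⟦ D (v 0) (v (2+ i)) ⟧ + ⟦ D (v (suc i)) (v (3 + (u + u))) ⟧) ≡ u + u)
  where

  open Facts c
  open Thresholds c
  private
    s r p : ℕ
    s = u + u
    r = 3 + s
    p = suc r

    u≤s : u ≤ s
    u≤s = m≤m+n u u
    2+u≤2+s : 2+ u ≤ 2+ s
    2+u≤2+s = s≤s (s≤s u≤s)
    2+s≤r : 2+ s ≤ r
    2+s≤r = n≤1+n _

  -- Otherwise `no-swap` denies `v (suc b)` all out-neighbours from `v (3 + u)` on. Of the first
  -- `3 + u` vertices, itself and its predecessor are also excluded, leaving one fewer than
  -- `out-low` demands.
  first-out : ∀ {b} → b ≤ u → ¬ v 0 ⟶ v (2+ b)
  first-out {b} b≤u 0b = <⇒≱ (≤-refl {4 + u}) (≤-trans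
      (≤-reflexive (trans (+-comm 2 (2+ u)) (cong (_+ 2) (sym (out-low (s≤s b≤u))))))
      (∑<-except-two f 3+u≤p 1+b<p b<p pointwise))
    where
    f = λ i → a (v (suc b)) (v i)
    3+u≤p : 3 + u ≤ p
    3+u≤p = ≤-trans (s≤s 2+u≤2+s) (n≤1+n _)
    1+b≤r : suc b ≤ r
    1+b≤r = ≤-trans (s≤s (≤-trans b≤u u≤s)) (m≤n+m (suc s) 2)
    1+b<p = s≤s 1+b≤r
    b<p = <⇒≤ 1+b<p
    far : ∀ {i} → 3 + u ≤ i → i ≤ r → ¬ v (suc b) ⟶ v i
    far {suc k} (s≤s 2+u≤k) k<r bi =
      no-swap (s≤s z≤n) (≤-trans (s≤s (s≤s b≤u)) 2+u≤k) k<r qw₀ 0b bi (high 2+u≤k (<⇒≤ k<r)) (low (s≤s z≤n))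
    pointwise : ∀ {i} → i < p → f i + (δℕ (suc b) i + δℕ b i) ≤ below (3 + u) i
    pointwise {i} i<p with suc b ≟ i | b ≟ i
    ... | yes refl | _ = ≤-reflexive (trans
      (cong₂ _+_ (⟦⟧≡0 (irrefl (v (suc b)))) (cong₂ _+_ (δℕ-refl (suc b)) (δℕ-≢ {b} (<⇒≢ ≤-refl))))
      (sym (below-< {3 + u} (s≤s (s≤s (≤-trans b≤u (n≤1+n u)))))))
    ... | no 1+b≢b | yes refl = ≤-reflexive (trans
      (cong₂ _+_ (⟦⟧≡0 (asym _ _ (arc {b} 1+b≤r))) (cong₂ _+_ (δℕ-≢ 1+b≢b) (δℕ-refl b)))
      (sym (below-< {3 + u} (s≤s (≤-trans b≤u (m≤n+m u 2))))))
    ... | no 1+b≢i | no b≢i with i <? 3 + u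
    ...   | yes i<3+u = ≤-trans (≤-reflexive (trans (cong (f i +_) (cong₂ _+_ (δℕ-≢ 1+b≢i) (δℕ-≢ b≢i))) (+-identityʳ (f i))))
      (≤-trans (⟦⟧≤1 (D (v (suc b)) (v i))) (≤-reflexive (sym (below-< i<3+u))))
    ...   | no i≮3+u = ≤-trans (≤-reflexive (cong₂ _+_ (⟦⟧≡0 (far (≮⇒≥ i≮3+u) (≤-pred i<p)))
      (cong₂ _+_ (δℕ-≢ 1+b≢i) (δℕ-≢ b≢i)))) z≤n

  -- Otherwise `no-swap` makes `v (suc b)` dominate `v 0`, ..., `v u`; with its successor on the
  -- path that is one more than `out-high` allows.
  last-in : ∀ {b} → suc u ≤ b → b ≤ suc s → ¬ v b ⟶ v r
  last-in {b} 1+u≤b b≤1+s br = <⇒≱ (≤-refl {2+ u}) (≤-trans (≤-reflexive (+-comm 1 (suc u))) (≤-trans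
      (∑<-extra-one (λ i → a (v (suc b)) (v i)) 1+u≤p 2+b<p pointwise)
      (≤-reflexive (out-high (s≤s 1+u≤b) 1+b≤r))))
    where
    1+u≤p : suc u ≤ p
    1+u≤p = ≤-trans (s≤s u≤s) (m≤n+m (suc s) 3)
    2+b<p : 2+ b < p
    2+b<p = s≤s (s≤s (s≤s b≤1+s))
    1+b≤r : suc b ≤ r
    1+b≤r = ≤-trans (s≤s b≤1+s) 2+s≤r
    near : ∀ {i} → i ≤ u → v (suc b) ⟶ v i
    near {i} i≤u = ¬arc⇒arc (v-≢ (≤-trans (≤-trans i≤u (≤-trans u≤s (n≤1+n s))) (m≤n+m _ 2)) 1+b≤r
        (<⇒≢ (s≤s (≤-trans i≤u (≤-trans (n≤1+n u) 1+u≤b)))))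
      λ ib → no-swap (≤-trans (s≤s i≤u) 1+u≤b) (s≤s b≤1+s) ≤-refl qw₀ ib br (high 2+u≤2+s 2+s≤r) (low (s≤s i≤u))
    pointwise : ∀ {i} → i < p → below (suc u) i + δℕ (2+ b) i ≤ a (v (suc b)) (v i)
    pointwise {i} i<p with i <? suc u | 2+ b ≟ i
    ... | yes i<1+u | no 2+b≢i = ≤-reflexive (trans (cong₂ _+_ (below-< i<1+u) (δℕ-≢ 2+b≢i))
      (sym (⟦⟧≡1 (near (≤-pred i<1+u)))))
    ... | yes 2+b<1+u | yes refl = contradiction (≤-trans (≤-trans (n≤1+n _) 2+b<1+u) 1+u≤b) (<⇒≱ (s≤s (n≤1+n b)))
    ... | no i≮1+u | yes refl = ≤-reflexive (trans (cong₂ _+_ (below-≥ (≮⇒≥ i≮1+u)) (δℕ-refl (2+ b)))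
      (sym (⟦⟧≡1 (arc (≤-pred i<p)))))
    ... | no i≮1+u | no 2+b≢i = ≤-trans (≤-reflexive (cong₂ _+_ (below-≥ (≮⇒≥ i≮1+u)) (δℕ-≢ 2+b≢i))) z≤n

  -- By `middle` exactly one index admits neither arc, and `first-out` with `last-in` shows that it
  -- is `u`.
  alternative : ∀ {i} → i ≤ s → i ≢ u → v 0 ⟶ v (2+ i) ⊎ v (suc i) ⟶ v r
  alternative {i} i≤s i≢u with T? (D (v 0) (v (2+ i))) | T? (D (v (suc i)) (v r))
  ... | yes 0i | _      = inj₁ 0i
  ... | no _   | yes ir = inj₂ ir
  ... | no ¬0i | no ¬ir = contradiction (zero-term-unique middle≤1 (cong suc middle) (s≤s i≤s) (s≤s u≤s)
    (cong₂ _+_ (⟦⟧≡0 ¬0i) (⟦⟧≡0 ¬ir))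
    (cong₂ _+_ (⟦⟧≡0 (first-out ≤-refl)) (⟦⟧≡0 (last-in ≤-refl (s≤s u≤s))))) i≢u

  out-alternative : ∀ {i} → u < i → i ≤ s → v 0 ⟶ v (2+ i)
  out-alternative u<i i≤s with alternative i≤s (>⇒≢ u<i)
  ... | inj₁ 0i = 0i
  ... | inj₂ ir = contradiction ir (last-in (≤-trans u<i (n≤1+n _)) (s≤s i≤s))

  in-alternative : ∀ {i} → i < u → v (suc i) ⟶ v r
  in-alternative i<u with alternative (≤-trans (<⇒≤ i<u) u≤s) (<⇒≢ i<u)
  ... | inj₁ 0i = contradiction 0i (first-out (<⇒≤ i<u))
  ... | inj₂ ir = ir

  -- With t = u + 2 the threshold of w₀, the longer path is
  -- v 0, v (r - 1), v t, …, v (r - 2), w₀, v (t - 1), v 1, …, v (t - 2), v r.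
  long-impossible : 2 ≤ u →
    (∀ {i j k l o w} → i < j → j < k → k < l → l < o → o < r → T (q w) →
      v i ⟶ v (suc l) → v o ⟶ v (suc k) → v l ⟶ w → w ⟶ v (suc j) → v k ⟶ v (suc i) → ¬ v j ⟶ v (suc o)) → ⊥
  long-impossible 2≤u no-reversal = no-reversal 0<u ≤-refl (s≤s u<s) ≤-refl ≤-refl qw₀
    (out-alternative u<s ≤-refl)
    (¬arc⇒arc (v-≢ 2+u≤r 2+s≤r (<⇒≢ (s≤s (s≤s u<s)))) λ ts →
      no-swap (s≤s z≤n) 2+u<1+s 2+s≤r qw₀ (out-alternative ≤-refl u<s) ts
        (high (<⇒≤ 2+u<1+s) (≤-trans (n≤1+n _) 2+s≤r)) (low (s≤s z≤n)))
    (high (<⇒≤ 2+u<1+s) (≤-trans (n≤1+n _) 2+s≤r))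
    (low ≤-refl)
    (¬arc⇒arc (v-≢ (s≤s z≤n) (≤-trans (n≤1+n _) 2+u≤r) (<⇒≢ (s≤s 0<u))) λ 1u →
      no-swap 2≤u (s≤s (m≤n⇒m≤1+n u≤s)) ≤-refl qw₀ 1u u-in (high 2+u≤2+s 2+s≤r) (low (m≤n⇒m≤1+n 2≤u)))
    u-in
    where
    0<u : 0 < u
    0<u = ≤-trans (n≤1+n 1) 2≤u
    u<s : u < s
    u<s = m<m+n u 0<u
    2+u<1+s : 2+ u < suc s
    2+u<1+s = s≤s (+-monoˡ-≤ u 2≤u)
    2+u≤r : 2+ u ≤ r
    2+u≤r = ≤-trans 2+u≤2+s 2+s≤r
    u-in : v u ⟶ v r
    u-in = subst (λ i → v i ⟶ v r) (suc-pred u {{>-nonZero 0<u}}) (in-alternative (pred-< u {{>-nonZero 0<u}}))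
      where
      pred-< : ∀ u .{{_ : NonZero u}} → pred u < u
      pred-< (suc u) = ≤-refl

  private
    from-first : ∀ {l} → v 0 ⟶ v l → l ≡ 1 ⊎ 3 + u ≤ l
    from-first {zero}     0l = contradiction 0l (irrefl (v 0))
    from-first {suc zero} 0l = inj₁ refl
    from-first {2+ l}     0l = inj₂ (s≤s (s≤s (≰⇒> λ l≤u → first-out l≤u 0l)))

    to-last : ∀ {l} → l ≤ r → v l ⟶ v r → l ≤ u ⊎ l ≡ 2+ s
    to-last {l} l≤r lr with l ≤? u | l ≟ 2+ s | l ≟ r
    ... | yes l≤u | _       | _        = inj₁ l≤u
    ... | no _    | yes l≡  | _        = inj₂ l≡
    ... | no _    | no _    | yes refl = contradiction lr (irrefl (v r))
    ... | no l≰u  | no l≢   | no l≢r   = contradiction lr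
      (last-in (≰⇒> l≰u) (≤-pred (≤∧≢⇒< (≤-pred (≤∧≢⇒< l≤r l≢r)) l≢)))

  -- For `u = 0` the arcs at the ends leave no two-path from `v 0` to `v r`. For `u = 1` a two-path
  -- from `v (r - 1)` to `v r` has to pass through `v 1`, and then none joins `v 1` to `v r`.
  short-impossible : 1 ≤ π → ¬ 2 ≤ u → ⊥
  short-impossible 1≤π 2≰u with 1 ≤? u
  short-impossible 1≤π 2≰u | no 1≰u with two-path-on-path 1≤π (s≤s z≤n) ≤-refl
  ... | l , l≤r , 0l , lr with from-first 0l | to-last l≤r lr
  ...   | inj₁ refl | inj₁ 1≤u  = 1≰u 1≤u
  ...   | inj₂ 3+u≤l | inj₁ l≤u = <⇒≱ (≤-trans (s≤s (m≤n+m u 2)) 3+u≤l) l≤u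
  ...   | inj₂ 3+u≤l | inj₂ refl = 1≰u (+-cancelʳ-≤ u 1 u (≤-pred (≤-pred 3+u≤l)))
  short-impossible 1≤π 2≰u | yes 1≤u with two-path-on-path 1≤π ≤-refl ≤-refl
  ... | l , l≤r , sl , lr with to-last l≤r lr
  ...   | inj₂ refl = irrefl _ sl
  ...   | inj₁ l≤u with l
  ...     | zero = asym _ _ sl (out-alternative (m<m+n u 1≤u) ≤-refl)
  ...     | 2+ l′ = 2≰u (≤-trans (s≤s (s≤s z≤n)) l≤u)
  ...     | suc zero with two-path-on-path 1≤π {1} {r} (s≤s (s≤s z≤n)) ≤-refl
  ...       | k , k≤r , 1k , kr with to-last k≤r kr
  ...         | inj₂ refl = asym _ _ sl 1k
  ...         | inj₁ k≤u with k
  ...           | zero      = asym _ _ 1k (arc (s≤s z≤n))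
  ...           | suc zero  = irrefl _ 1k
  ...           | 2+ k′     = 2≰u (≤-trans (s≤s (s≤s z≤n)) k≤u)

-- Kept apart from `Config`, since this exchange enters only in the case of one mixed vertex, where
-- the path is not reversed.
NoReversal : Digraph n → (ℕ → Fin n) → (Fin n → Bool) → ℕ → Set
NoReversal D v q r = ∀ {i j k l o w} → i < j → j < k → k < l → l < o → o < r → T (q w) →
  v i ⟶[ D ] v (suc l) → v o ⟶[ D ] v (suc k) → v l ⟶[ D ] w → w ⟶[ D ] v (suc j) →
  v k ⟶[ D ] v (suc i) → ¬ v j ⟶[ D ] v (suc o)

-- Eliminating `σ` shows that `p` divides `2 t`; as `0 < 2 t < 2 p`, this leaves `2 t = p`.
threshold-half : ∀ {p d σ t} → 2 * (p * d) + p ≡ p * p + 2 * σ → σ + t ≡ p → 1 ≤ t → t < p →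
  2 * t ≡ p × d ≡ t
threshold-half {p} {d} {σ} {t} arcs σ+t 1≤t t<p = 2t≡p , *-cancelˡ-≡ d t 2 (trans 2d≡p (sym 2t≡p))
  where
  open ≡-Reasoning
  instance
    p≢0 : NonZero p
    p≢0 = >-nonZero (≤-trans (s≤s z≤n) t<p)
  total : p * (2 * d) + 2 * t ≡ p * p + p
  total = +-cancelʳ-≡ p _ _ (begin
    p * (2 * d) + 2 * t + p      ≡⟨ regroup p d t ⟩
    2 * (p * d) + p + 2 * t      ≡⟨ cong (_+ 2 * t) arcs ⟩
    p * p + 2 * σ + 2 * t        ≡⟨ regroup′ (p * p) σ t ⟩
    p * p + 2 * (σ + t)          ≡⟨ cong (λ k → p * p + 2 * k) σ+t ⟩
    p * p + 2 * p                ≡⟨ regroup″ p ⟩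
    p * p + p + p                ∎)
    where
    regroup : ∀ p d t → p * (2 * d) + 2 * t + p ≡ 2 * (p * d) + p + 2 * t
    regroup = solve-∀
    regroup′ : ∀ x σ t → x + 2 * σ + 2 * t ≡ x + 2 * (σ + t)
    regroup′ = solve-∀
    regroup″ : ∀ p → p * p + 2 * p ≡ p * p + p + p
    regroup″ = solve-∀
  p∣2t : p ∣ 2 * t
  p∣2t = ∣m+n∣m⇒∣n (subst (p ∣_) (sym total) (∣m∣n⇒∣m+n (m∣m*n p) ∣-refl)) (m∣m*n (2 * d))
  2t≡p : 2 * t ≡ p
  2t≡p with p∣2t
  ... | divides zero eq = contradiction (≤-trans (*-monoʳ-≤ 2 1≤t) (≤-reflexive eq)) λ ()
  ... | divides (suc zero) eq = trans eq (+-identityʳ p)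
  ... | divides (2+ k) eq = contradiction (≤-trans (*-monoˡ-≤ p {2} {2+ k} (s≤s (s≤s z≤n))) (≤-reflexive (sym eq)))
    (<⇒≱ (*-monoʳ-< 2 t<p))
  2d≡p : 2 * d ≡ p
  2d≡p = *-cancelˡ-≡ (2 * d) p p (+-cancelʳ-≡ p _ _ (trans (cong (p * (2 * d) +_) (sym 2t≡p)) total))

-- Meant to be read modulo `p`, which must divide `2 (t + t′)`.
two-thresholds : ∀ {p d σ σ′ t t′} → 2 * (p * d) + p ≡ p * p + 2 * (σ + σ′) → σ + t ≡ p → σ′ + t′ ≡ p →
  p * (2 * d) + 2 * (t + t′) ≡ p * (p + 3)
two-thresholds {p} {d} {σ} {σ′} {t} {t′} arcs σ+t σ′+t′ = +-cancelʳ-≡ p _ _ (begin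
  p * (2 * d) + 2 * (t + t′) + p       ≡⟨ regroup p d (t + t′) ⟩
  2 * (p * d) + p + 2 * (t + t′)       ≡⟨ cong (_+ 2 * (t + t′)) arcs ⟩
  p * p + 2 * (σ + σ′) + 2 * (t + t′)  ≡⟨ regroup′ (p * p) σ σ′ t t′ ⟩
  p * p + 2 * ((σ + t) + (σ′ + t′))    ≡⟨ cong₂ (λ j k → p * p + 2 * (j + k)) σ+t σ′+t′ ⟩
  p * p + 2 * (p + p)                  ≡⟨ regroup″ p ⟩
  p * (p + 3) + p                      ∎)
  where
  open ≡-Reasoning
  regroup : ∀ p d t → p * (2 * d) + 2 * t + p ≡ 2 * (p * d) + p + 2 * t
  regroup = solve-∀
  regroup′ : ∀ x σ σ′ t t′ → x + 2 * (σ + σ′) + 2 * (t + t′) ≡ x + 2 * ((σ + t) + (σ′ + t′))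
  regroup′ = solve-∀
  regroup″ : ∀ p → p * p + 2 * (p + p) ≡ p * (p + 3) + p
  regroup″ = solve-∀

-- `s ≡ u + u` is a separate argument so that matching it puts the path length into the form
-- required by `SingleMixed`.
one-mixed : ∀ {D : Digraph n} {v q m s π} u (c : Config D v q m (3 + s) π) → s ≡ u + u → 1 ≤ π →
  ∀ {w₀} → T (q w₀) → w₀ ⟶[ D ] v 0 → v (3 + s) ⟶[ D ] w₀ →
  Thresholds.IsThreshold c w₀ (2+ u) → sum (Facts.mixed c) ≡ 1 → Facts.out-on-path c 0 ≡ 2+ u →
  (∀ {i} → i < suc s → ⟦ D (v 0) (v (2+ i)) ⟧ + ⟦ D (v (suc i)) (v (3 + s)) ⟧ ≤ 1) →
  ∑< (suc s) (λ i → ⟦ D (v 0) (v (2+ i)) ⟧ + ⟦ D (v (suc i)) (v (3 + s)) ⟧) ≡ s →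
  NoReversal D v q (3 + s) → ⊥
one-mixed {D = D} {v} u c refl 1≤π {w₀} qw₀ w₀0 rw₀ (_ , low , high) mixed≡1 d₁≡ middle≤1 middle no-reversal =
  S.short-impossible 1≤π λ 2≤u → S.long-impossible 2≤u no-reversal
  where
  module F = Facts c
  degree : ∀ {b} → b ≤ 3 + (u + u) → F.out-on-path b + F.a (v b) w₀ ≡ 2+ u
  degree {b} b≤r = trans (cong (F.out-on-path b +_) (sym (weighted-sum-1 {f = F.mixed} {w₀}
    (≤-reflexive (sym (Thresholds.mixed-intro c qw₀ w₀0 rw₀))) mixed≡1 (F.a (v b))))) (trans (F.mixed-out-degree b≤r) d₁≡)
  out-low : ∀ {b} → b ≤ suc u → F.out-on-path b ≡ 2+ u
  out-low {b} b≤1+u = trans (sym (trans (cong (F.out-on-path b +_) (⟦⟧≡0 (F.asym _ _ (low (s≤s b≤1+u)))))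
    (+-identityʳ _))) (degree (≤-trans b≤1+u (≤-trans (s≤s (m≤m+n u u)) (m≤n+m (suc (u + u)) 2))))
  out-high : ∀ {b} → 2+ u ≤ b → b ≤ 3 + (u + u) → F.out-on-path b ≡ suc u
  out-high {b} 2+u≤b b≤r = +-cancelʳ-≡ 1 _ _ (trans (cong (F.out-on-path b +_) (sym (⟦⟧≡1 (high 2+u≤b b≤r))))
    (trans (degree b≤r) (+-comm 1 (suc u))))
  module S = SingleMixed u c qw₀ (λ i≤ → low (s≤s i≤)) high out-low out-high middle≤1 middle

-- `penultimate-impossible` covers `t ≤ r - 2` with `t′ ≤ r - 1` and, after reversal, `t ≥ 3` with
-- `t′ ≥ 2`. The remaining pairs violate the congruence modulo `p`.
two-mixed : ∀ {D : Digraph n} {v q m s π} (c : Config D v q m (3 + s) π) → 1 ≤ π →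
  ∀ {w₀ t} → T (q w₀) → Thresholds.IsThreshold c w₀ t → 2 ≤ t → t ≤ 2+ s → sum (Facts.mixed c) ≢ 2
two-mixed {D = D} {v} {q} {m} {s} {π} c 1≤π {w₀} {t} qw₀ (t≤p , low , high) 2≤t t≤2+s mixed≡2
  with weighted-sum-2 {f = Facts.mixed c} {w₀} (≤-reflexive (sym (Thresholds.mixed-intro c qw₀
    (low (≤-trans (s≤s z≤n) 2≤t)) (high (m≤n⇒m≤1+n t≤2+s) ≤-refl)))) mixed≡2
... | w₁ , 1≤mixed , weighted with Thresholds.mixed-elim c 1≤mixed
... | qw₁ , w₁0 , rw₁ with Thresholds.threshold c qw₁
... | t′ , t′≤p , low′ , high′ = cases
  where
  open Facts c
  r p : ℕ
  r = 3 + s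
  p = 4 + s
  1≤t′ : 1 ≤ t′
  1≤t′ = ≰⇒> λ t′≤0 → asym _ _ w₁0 (high′ t′≤0 z≤n)
  t′≤r : t′ ≤ r
  t′≤r = ≮⇒≥ λ r<t′ → asym _ _ rw₁ (low′ r<t′)
  equation : p * (2 * out-on-path 0) + 2 * (t + t′) ≡ p * (p + 3)
  equation = two-thresholds {p} {out-on-path 0} {∑< p (λ b → a (v b) w₀)} {∑< p (λ b → a (v b) w₁)} {t} {t′}
    (trans arcs-on-path (cong (λ k → p * p + 2 * k) (weighted λ w → ∑< p (λ b → a (v b) w))))
    (Thresholds.threshold-count c (t≤p , low , high)) (Thresholds.threshold-count c (t′≤p , low′ , high′))
  p∣2[t+t′] : p ∣ 2 * (t + t′)
  p∣2[t+t′] = ∣m+n∣m⇒∣n (subst (p ∣_) (sym equation) (m∣m*n (p + 3))) (m∣m*n (2 * out-on-path 0))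
  p∤2 : ¬ p ∣ 2
  p∤2 p∣2 = contradiction (∣⇒≤ p∣2) λ { (s≤s (s≤s ())) }
  late-ends : t ≤ 1 + s → t′ ≤ 2+ s → ⊥
  late-ends t≤1+s t′≤2+s = penultimate-impossible c 1≤π qw₀ (low 2≤t) (high t≤1+s (≤-trans (n≤1+n _) (n≤1+n _)))
    (trans (weighted (a (v (2+ s)))) (cong₂ _+_ (⟦⟧≡1 (high t≤2+s (n≤1+n _))) (⟦⟧≡1 (high′ t′≤2+s (n≤1+n _)))))
  early-ends : 3 ≤ t → 2 ≤ t′ → ⊥
  early-ends 3≤t 2≤t′ = penultimate-impossible (reverse c) 1≤π qw₀ (high t≤2+s (n≤1+n _))
    (subst (λ x → w₀ ⟶ v x) (sym (m+n∸n≡m 2 s)) (low 3≤t))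
    (trans (sum-cong-≗ pointwise) (trans (weighted (λ w → a w (v 1)))
      (cong₂ _+_ (⟦⟧≡1 (low 2≤t)) (⟦⟧≡1 (low′ 2≤t′)))))
    where
    pointwise : ∀ w → o w * (a (v r) w * a w (v (s ∸ s))) * a w (v (1 + s ∸ s)) ≡ mixed w * a w (v 1)
    pointwise w = cong₂ _*_ (cong (o w *_) (trans (*-comm (a (v r) w) _) (cong (λ i → a w (v i) * a (v r) w) (n∸n≡0 s))))
      (cong (λ i → a w (v i)) (m+n∸n≡m 1 s))
  cases : ⊥
  cases with t ≤? 1 + s | t′ ≤? 2+ s | 3 ≤? t | 2 ≤? t′
  ... | yes t≤1+s | yes t′≤2+s | _ | _ = late-ends t≤1+s t′≤2+s
  ... | _ | _ | yes 3≤t | yes 2≤t′ = early-ends 3≤t 2≤t′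
  -- Here `2 (t + t′) = 2 p + 2`.
  ... | _ | no t′≰2+s | no 3≰t | _ = p∤2 (∣m+n∣m⇒∣n (subst (p ∣_) (sum-equation t≡2 t′≡r) p∣2[t+t′]) (m∣m*n 2))
    where
    t≡2 : t ≡ 2
    t≡2 = ≤-antisym (≤-pred (≰⇒> 3≰t)) 2≤t
    t′≡r : t′ ≡ r
    t′≡r = ≤-antisym t′≤r (≰⇒> t′≰2+s)
    sum-equation : ∀ {s t t′} → t ≡ 2 → t′ ≡ 3 + s → 2 * (t + t′) ≡ (4 + s) * 2 + 2
    sum-equation {s} refl refl = expand s
      where
      expand : ∀ s → 2 * (2 + (3 + s)) ≡ (4 + s) * 2 + 2
      expand = solve-∀
  ... | _ | no t′≰2+s | yes _ | no 2≰t′ = contradiction (≤-trans (s≤s (s≤s z≤n)) (≰⇒> t′≰2+s)) 2≰t′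
  -- Here `2 (t + t′) = 2 p - 2`.
  ... | no t≰1+s | yes _ | yes _ | no 2≰t′ = p∤2 (∣m+n∣m⇒∣n (subst (p ∣_) (sum-equation t≡2+s t′≡1) (m∣m*n 2)) p∣2[t+t′])
    where
    t≡2+s : t ≡ 2+ s
    t≡2+s = ≤-antisym t≤2+s (≰⇒> t≰1+s)
    t′≡1 : t′ ≡ 1
    t′≡1 = ≤-antisym (≤-pred (≰⇒> 2≰t′)) 1≤t′
    sum-equation : ∀ {s t t′} → t ≡ 2+ s → t′ ≡ 1 → (4 + s) * 2 ≡ 2 * (t + t′) + 2
    sum-equation {s} refl refl = expand s
      where
      expand : ∀ s → (4 + s) * 2 ≡ 2 * (2+ s + 1) + 2
      expand = solve-∀
  -- Only `p = 4` remains; halving the equation shows that 4 divides `t′`, which lies between 1 and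
  -- 3.
  ... | no t≰1+s | yes t′≤2+s | no 3≰t | _ = four-vertices {out-on-path 0} s≡0 t≡2 1≤t′ t′≤r equation
    where
    t≡2 : t ≡ 2
    t≡2 = ≤-antisym (≤-pred (≰⇒> 3≰t)) 2≤t
    s≡0 : s ≡ 0
    s≡0 = n≤0⇒n≡0 (≤-pred (≤-pred (≤-trans (≰⇒> t≰1+s) (≤-reflexive t≡2))))
    four-vertices : ∀ {d s t t′} → s ≡ 0 → t ≡ 2 → 1 ≤ t′ → t′ ≤ 3 + s →
      (4 + s) * (2 * d) + 2 * (t + t′) ≢ (4 + s) * (4 + s + 3)
    four-vertices {d} {t′ = t′} refl refl 1≤t′ t′≤3 eq = contradiction (∣⇒≤ {{>-nonZero 1≤t′}} 4∣t′) (<⇒≱ (s≤s t′≤3))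
      where
      halved : 4 * d + t′ ≡ 12
      halved = *-cancelˡ-≡ _ _ 2 (+-cancelʳ-≡ 4 _ _ (trans (expand d t′) eq))
        where
        expand : ∀ d t → 2 * (4 * d + t) + 4 ≡ 4 * (2 * d) + 2 * (2 + t)
        expand = solve-∀
      4∣t′ : 4 ∣ t′
      4∣t′ = ∣m+n∣m⇒∣n (subst (4 ∣_) (sym halved) (divides 3 refl)) (m∣m*n d)

-- `middle` rewrites `end-degrees`. As `M ≤ s + 1` and `ε ≤ 1`, at most two vertices are mixed; `w₀`
-- is one of them.
deep-impossible : ∀ {D : Digraph n} {v q m s π} → Config D v q m (3 + s) π → 1 ≤ π → NoReversal D v q (3 + s) →
  ∀ {w₀} → T (q w₀) → w₀ ⟶[ D ] v 1 → ¬ v (2+ s) ⟶[ D ] w₀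
deep-impossible {D = D} {v} {q} {m} {s} {π} c 1≤π no-reversal {w₀} qw₀ w₀1 sw₀ = cases
  where
  open Facts c
  open Thresholds c
  r p : ℕ
  r = 3 + s
  p = 4 + s
  2+s≤r : 2+ s ≤ r
  2+s≤r = n≤1+n _
  w₀0 : w₀ ⟶ v 0
  w₀0 = out-initial qw₀ z≤n (s≤s z≤n) w₀1
  rw₀ : v r ⟶ w₀
  rw₀ = in-final qw₀ 2+s≤r ≤-refl sw₀
  F E : ℕ → ℕ
  F i = a (v 0) (v (2+ i))
  E i = a (v (suc i)) (v r)
  ε M : ℕ
  ε = a (v 0) (v r)
  M = ∑< (suc s) (λ i → F i + E i)
  middle≤1 : ∀ {i} → i < suc s → F i + E i ≤ 1
  middle≤1 {i} i<1+s with T? (D (v 0) (v (2+ i))) | T? (D (v (suc i)) (v r))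
  ... | yes 0i | yes ir = contradiction w₀1 (no-swap (s≤s z≤n) (s≤s i<1+s) ≤-refl qw₀ 0i ir sw₀)
  ... | yes _  | no ¬ir rewrite ⟦⟧≡0 ¬ir | +-identityʳ (F i) = ⟦⟧≤1 (D (v 0) (v (2+ i)))
  ... | no ¬0i | _      rewrite ⟦⟧≡0 ¬0i = ⟦⟧≤1 (D (v (suc i)) (v r))
  M≤1+s : M ≤ suc s
  M≤1+s = ≤-trans (∑<-mono {suc s} middle≤1) (≤-reflexive (sum-const-1 (suc s)))
  out≡ : out-on-path 0 ≡ 1 + (∑< (suc s) F + ε)
  out≡ = cong₂ _+_ (⟦⟧≡0 (irrefl (v 0))) (cong₂ _+_ (⟦⟧≡1 (arc (s≤s z≤n))) (∑<-last (suc s) F))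
  in≡ : in-on-path r ≡ ε + (∑< (suc s) E + 1 + 0)
  in≡ = cong (ε +_) (trans (∑<-last (2+ s) E) (cong₂ _+_
    (trans (∑<-last (suc s) E) (cong (∑< (suc s) E +_) (⟦⟧≡1 (arc ≤-refl)))) (⟦⟧≡0 (irrefl (v r)))))
  middle : M + 2 * ε ≡ suc s + sum mixed
  middle = +-cancelˡ-≡ 2 _ _ (begin
    2 + (M + 2 * ε)
      ≡⟨ cong (λ k → 2 + (k + 2 * ε)) (∑<-+ (suc s) F E) ⟩
    2 + (∑< (suc s) F + ∑< (suc s) E + 2 * ε)
      ≡⟨ regroup (∑< (suc s) F) (∑< (suc s) E) ε ⟩
    1 + (∑< (suc s) F + ε) + (ε + (∑< (suc s) E + 1 + 0))
      ≡⟨ cong₂ _+_ out≡ in≡ ⟨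
    out-on-path 0 + in-on-path r
      ≡⟨ end-degrees ⟩
    3 + s + sum mixed ∎)
    where
    open ≡-Reasoning
    regroup : ∀ f e ε → 2 + (f + e + 2 * ε) ≡ 1 + (f + ε) + (ε + (e + 1 + 0))
    regroup = solve-∀
  mixed₀ : 1 ≤ mixed w₀
  mixed₀ = ≤-reflexive (sym (mixed-intro qw₀ w₀0 rw₀))
  half : sum mixed ≡ 1 → ∀ {t} → IsThreshold w₀ t → 2 ≤ t → t ≤ 2+ s → 2 * t ≡ p × out-on-path 0 ≡ t
  half mixed≡1 {t} is 2≤t t≤2+s = threshold-half {p} {out-on-path 0} {∑< p (λ b → a (v b) w₀)} {t}
    (trans arcs-on-path (cong (λ k → p * p + 2 * k)
      (weighted-sum-1 {f = mixed} {w₀} mixed₀ mixed≡1 λ w → ∑< p (λ b → a (v b) w))))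
    (threshold-count is) (≤-trans (s≤s z≤n) 2≤t) (s≤s (≤-trans t≤2+s 2+s≤r))
  single-case : sum mixed ≡ 1 → ∀ {t} → IsThreshold w₀ t → 2 ≤ t → 2 * t ≡ p → out-on-path 0 ≡ t → ⊥
  single-case mixed≡1 {2+ u} is 2≤t 2t≡p d≡t = one-mixed u c
    (+-cancelˡ-≡ 4 _ _ (trans (sym 2t≡p) (expand u))) 1≤π qw₀ w₀0 rw₀ is mixed≡1 d≡t middle≤1 M≡s no-reversal
    where
    expand : ∀ u → 2 * (2 + u) ≡ 4 + (u + u)
    expand = solve-∀
    -- Now `M + 2 * ε = s + 2`, and `M ≤ s + 1` forces `ε = 1`.
    M≡s : M ≡ s
    M≡s = determined (⟦⟧≤1 (D (v 0) (v r))) M≤1+s (trans middle (cong (suc s +_) mixed≡1))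
      where
      determined : ∀ {M s ε} → ε ≤ 1 → M ≤ suc s → M + 2 * ε ≡ suc s + 1 → M ≡ s
      determined {M} {s} {zero} _ M≤ eq = contradiction M≤ (<⇒≱ (≤-reflexive (sym (trans (sym (+-identityʳ M))
        (trans eq (+-comm (suc s) 1))))))
      determined {M} {s} {suc zero} _ _ eq = +-cancelʳ-≡ 2 M s (trans eq (sym (+-suc s 1)))
      determined {ε = 2+ _} (s≤s ()) _ _
  single-case mixed≡1 {suc zero} is (s≤s ()) _ _
  cases : ⊥
  cases with threshold qw₀
  ... | t , is@(t≤p , low , high) = by-count (sum mixed) refl
    where
    2≤t : 2 ≤ t
    2≤t = ≮⇒≥ λ t<2 → asym _ _ w₀1 (high (≤-pred t<2) (s≤s z≤n))
    t≤2+s : t ≤ 2+ s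
    t≤2+s = ≮⇒≥ λ 2+s<t → asym _ _ sw₀ (low 2+s<t)
    by-count : ∀ c → sum mixed ≡ c → ⊥
    by-count zero eq = contradiction (≤-trans (≤-trans mixed₀ (term≤sum mixed w₀)) (≤-reflexive eq)) λ ()
    by-count (suc zero) eq = (let 2t≡p , d≡t = half eq is 2≤t t≤2+s in single-case eq is 2≤t 2t≡p d≡t)
    by-count (2+ zero) eq = two-mixed c 1≤π qw₀ is 2≤t t≤2+s eq
    by-count (2+ (suc k)) eq = contradiction (+-mono-≤ M≤1+s (*-monoʳ-≤ 2 (⟦⟧≤1 (D (v 0) (v r)))))
      (<⇒≱ (≤-trans (+-monoʳ-< (suc s) (s≤s (s≤s (s≤s (z≤n {k}))))) (≤-reflexive (sym (trans middle (cong (suc s +_) eq))))))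

-- The contradiction, and its transfer to paths given as lists

path-config-impossible : ∀ {D : Digraph n} {v q m r π} → Config D v q m r π → NoReversal D v q r →
  1 ≤ r → 1 ≤ π → n < 12 * π + 9 → ¬ suc r ≡ n → ⊥
path-config-impossible {n = n} {D} {v} {q} {m} {r} {π} c no-reversal 1≤r 1≤π n<12π+9 p≢n with outside
  where
  open Facts c
  outside : ∃ λ w → T (q w)
  outside with sum o in eq
  ... | zero = contradiction (sym (begin
          n                                          ≡⟨ sum-const-1 n ⟨
          sum {n} (λ _ → 1)                          ≡⟨ sum-split (λ _ → 1) ⟩
          ∑< (suc r) (λ _ → 1) + sum (λ w → o w * 1) ≡⟨ cong₂ _+_ (sum-const-1 (suc r)) (weighted-sum-0 {f = o} eq (λ _ → 1)) ⟩
          suc r + 0                                  ≡⟨ +-identityʳ (suc r) ⟩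
          suc r                                      ∎)) p≢n
    where open ≡-Reasoning
  ... | suc _ with sum-positive o (≤-trans (s≤s z≤n) (≤-reflexive (sym eq)))
  ...   | w , 1≤ with q w in qw
  ...     | true = w , subst T (sym qw) tt
... | w₀ , qw₀ = by-length c no-reversal 1≤r
  where
  by-length : ∀ {r} → Config D v q m r π → NoReversal D v q r → 1 ≤ r → ⊥
  by-length {suc zero} c _ _ with Thresholds.two-path-on-path c 1≤π (s≤s z≤n) ≤-refl
  ... | zero     , _ , 0→0 , _  = Facts.irrefl c (v 0) 0→0
  ... | suc zero , _ , _  , 1→1 = Facts.irrefl c (v 1) 1→1
  ... | 2+ l , s≤s () , _
  -- With `r = 2` the vertices `v 1` and `v (r - 1)` coincide, so no threshold lies strictly between
  -- the two ranges.
  by-length {2+ zero} c _ _ = shallow-impossible c 1≤π n<12π+9 qw₀ λ _ w1 1w → Facts.asym c _ _ w1 1w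
  by-length {2+ (suc s)} c no-reversal _ = shallow-impossible c 1≤π n<12π+9 qw₀ (deep-impossible c 1≤π no-reversal)

-- The bound on `π₂` is imposed on every pair of distinct vertices, with the fraction cleared.
theorem6 : (n : ℕ) → (T : Digraph n) → IsTournament T → IsRegular T → 9 ≤ n →
    (∀ (u v : Fin n) → u ≢ v → n < 12 * p₂ T u v + 9) →
    PathExtendable T
theorem6 n D tournament regular 9≤n many P@(x ∷ y ∷ ys) (walk , unique) (s≤s (s≤s _)) nonhamiltonian =
  extendable-by-contradiction λ maximal →
    ⊥-elim (path-config-impossible (config maximal) (λ {i} {j} {k} {l} {o} {w} → no-reversal maximal {i} {j} {k} {l} {o} {w})
      (s≤s z≤n) (s≤s z≤n) n<12π+9 nonhamiltonian)
  where
  r m π excess : ℕ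
  r = suc (length ys)
  m = outdeg D x
  excess = (n ∸ 9) / 12
  -- The least integer exceeding `(n - 9) / 12`: it bounds each `p₂` from below and still satisfies
  -- `n < 12 * π + 9`.
  π = suc excess
  v : ℕ → Fin n
  v = nth x P
  q : Fin n → Bool
  q w = not (does (_∈?_ Fin._≟_ w P))
  P≡ : segment v 0 (suc r) ≡ P
  P≡ = segment-nth x P
  q⇒∉ : ∀ {w} → T (q w) → w ∉ P
  q⇒∉ {w} qw w∈ = subst (λ b → T (not b)) (dec-true (_∈?_ Fin._≟_ w P) w∈) qw
  -- Regularity and `degree-sum` give `2 * outdeg D z + 1 ≡ n` at each vertex, so all out-degrees
  -- equal that of `x`.
  outs : ∀ z → sum (λ y → ⟦ D z y ⟧) ≡ m
  outs z = trans (sym (countV≡sum (D z))) (*-cancelˡ-≡ _ _ 2 (+-cancelʳ-≡ 1 _ _ (trans (total z) (sym (total x)))))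
    where
    total : ∀ z → 2 * outdeg D z + 1 ≡ n
    total z = trans (cong (_+ 1) (trans (cong (outdeg D z +_) (+-identityʳ _))
      (cong₂ _+_ (countV≡sum (D z)) (trans (regular z) (countV≡sum (λ w → D w z)))))) (degree-sum tournament z)
  ins : ∀ z → sum (λ y → ⟦ D y z ⟧) ≡ m
  ins z = trans (sym (countV≡sum (λ y → D y z))) (trans (sym (regular z)) (trans (countV≡sum (D z)) (outs z)))
  n<12π+9 : n < 12 * π + 9
  n<12π+9 = begin-strict
    n                                     ≡⟨ m∸n+n≡m 9≤n ⟨
    n ∸ 9 + 9                             ≡⟨ cong (_+ 9) (m≡m%n+[m/n]*n (n ∸ 9) 12) ⟩
    (n ∸ 9) % 12 + excess * 12 + 9        <⟨ +-monoˡ-< 9 (+-monoˡ-< (excess * 12) (m%n<n (n ∸ 9) 12)) ⟩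
    π * 12 + 9                            ≡⟨ cong (_+ 9) (*-comm π 12) ⟩
    12 * π + 9                            ∎
    where open ≤-Reasoning
  two-paths : ∀ {u w} → u ≢ w → π ≤ sum (λ z → ⟦ D u z ⟧ * ⟦ D z w ⟧)
  two-paths {u} {w} u≢w = ≤-trans (m<n*o⇒m/o<n (+-cancelʳ-< 9 _ _ (begin-strict
      n ∸ 9 + 9             ≡⟨ m∸n+n≡m 9≤n ⟩
      n                     <⟨ many u w u≢w ⟩
      12 * p₂ D u w + 9     ≡⟨ cong (_+ 9) (*-comm 12 (p₂ D u w)) ⟩
      p₂ D u w * 12 + 9     ∎)))
    (≤-reflexive (trans (countV≡sum (λ z → D u z ∧ D z w)) (sum-cong-≗ λ z → ⟦∧⟧ (D u z) (D z w))))
    where open ≤-Reasoning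
  module _ (maximal : ∀ P′ w → ExtendedBy D P P′ w → length P′ ≢ suc (length P)) where
    private
      module X = Exchange {D = D} r v (subst Unique (sym P≡) unique) (λ i<r → nth-arc x walk (s≤s i<r))
        (subst (λ xs → ∀ P′ w → ExtendedBy D xs P′ w → length P′ ≢ suc (length xs)) (sym P≡) maximal)
      ∉-segment : ∀ {w} → T (q w) → w ∉ segment v 0 (suc r)
      ∉-segment {w} qw w∈ = q⇒∉ {w} qw (subst (w ∈_) P≡ w∈)
    no-reversal : NoReversal D v q r
    no-reversal i<j j<k k<l l<o o<r qw = X.no-reversal i<j j<k k<l l<o o<r (∉-segment qw)
    config : Config D v q m r π
    config = record
      { tournament   = tournament
      ; outs         = outs
      ; ins          = ins
      ; injective    = λ i≤r j≤r → nth-injective x unique (s≤s i≤r) (s≤s j≤r)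
      ; off          = λ { qw i≤r refl → q⇒∉ qw (nth-∈ x P (s≤s i≤r)) }
      ; on           = on
      ; arc          = λ i<r → nth-arc x walk (s≤s i<r)
      ; no-insertion = λ i<r qw → X.no-insertion i<r (∉-segment qw)
      ; no-swap      = λ i<j j<k k<r qw → X.no-swap i<j j<k k<r (∉-segment qw)
      ; two-paths    = two-paths
      }
      where
      on : ∀ {w} → ¬ T (q w) → ∃ λ i → i ≤ r × v i ≡ w
      on {w} ¬qw with _∈?_ Fin._≟_ w P
      ... | no w∉ = contradiction (subst (λ b → T (not b)) (sym (dec-false (_∈?_ Fin._≟_ w P) w∉)) tt) ¬qw
      ... | yes w∈ with ∈-segment v 0 (suc r) (subst (w ∈_) (sym P≡) w∈)
      ...   | i , i<p , eq = i , ≤-pred i<p , eq
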